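{- Assume there is a polynomial-time $\gamma$-approximation algorithm for makespan minimization on identical machines and a polynomial-time $\gamma_{\mathrm{rob}}$-approximation algorithm for robust makespan minimization over $\mathcal U$ on identical machines. Then, for general (nonempty bounded) uncertainty sets $\mathcal U\subseteq\mathbb R_{\ge0}^n$ and identical machines, for every $\lambda>0$ there is a polynomial-time algorithm with consistency $\gamma(1+2/\lambda)$ and robustness $(2\lambda+4)\gamma_{\mathrm{rob}}$; that is, for every predicted scenario $\hat p\in\mathcal U$ it returns in polynomial time a schedule $\mathcal S$ with $$C_{\max}(\mathcal S,\hat p)\le\gamma\Big(1+\frac2\lambda\Big)\mathrm{OPT}(\hat p)\quad\text{and}\quad\sup_{p\in\mathcal U}C_{\max}(\mathcal S,p)\le(2\lambda+4)\gamma_{\mathrm{rob}}\,\mathrm{OPT}^{\mathrm{rob}}(\mathcal U).$$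
   Context: There are $m$ identical machines and $n$ jobs; a scenario is a vector $p\in\mathbb R_{\ge0}^n$ of job sizes. A schedule is a partition $\mathcal S=(S_1,\dots,S_m)$ of $[n]$ (parts may be empty), and $C_{\max}(\mathcal S,p)=\max_{i\in[m]}\sum_{j\in S_i}p_j$. $\mathrm{OPT}(p)=\min_{\mathcal S}C_{\max}(\mathcal S,p)$ and $\mathrm{OPT}^{\mathrm{rob}}(\mathcal U)=\min_{\mathcal S}\sup_{p\in\mathcal U}C_{\max}(\mathcal S,p)$. A $\gamma$-approximation algorithm for makespan minimization returns on every $p$ a schedule $\mathcal S$ with $C_{\max}(\mathcal S,p)\le\gamma\,\mathrm{OPT}(p)$; a $\gamma_{\mathrm{rob}}$-approximation algorithm for robust makespan minimization over $\mathcal U$ returns a schedule $\mathcal S$ with $\sup_{p\in\mathcal U}C_{\max}(\mathcal S,p)\le\gamma_{\mathrm{rob}}\,\mathrm{OPT}^{\mathrm{rob}}(\mathcal U)$. The uncertainty set may be given implicitly; it is accessed only through the assumed robust approximation algorithm. -}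

module Defs where

open import Algebra.Bundles using (CommutativeRing)
open import Algebra.Structures using (IsCommutativeRing)
import Algebra.Construct.NaturalChoice.Max as Max
import Algebra.Construct.NaturalChoice.Min as Min
import Algebra.Properties.CommutativeMonoid.Sum as Sum
open import Data.Bool.Base using (if_then_else_)
open import Data.Fin.Base using (Fin; toℕ; finToFun)
open import Data.Fin.Properties using (_≟_)
open import Data.Fin.Subset using (Subset)
open import Data.List.Base as List using (List; []; _∷_)
open import Data.List.Membership.Propositional using (_∈_)
open import Data.List.Relation.Unary.All as All using (All; []; _∷_)
open import Data.Nat.Base as ℕ using (ℕ; suc; NonZero)
open import Data.Nat.Properties using (m^n≢0)
open import Data.Product.Base using (Σ; ∃; _×_; _,_)
open import Data.Sum.Base using (_⊎_; inj₁; inj₂)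
open import Data.Unit.Base using (⊤; tt)
open import Data.Vec.Base as Vec using (Vec)
open import Level using (0ℓ)
open import Relation.Binary.Bundles using (TotalOrder)
open import Relation.Binary.Core using (Rel)
open import Relation.Binary.Structures using (IsDecTotalOrder)
open import Relation.Binary.PropositionalEquality using (_≡_; _≢_)
open import Relation.Nullary using (¬_; does)
open import Relation.Unary using (Pred)

-- The (classical) real numbers, presented by the axioms that determine them
-- up to isomorphism.
record CompleteOrderedField : Set₁ where
  infix  4 _≤_ _<_
  infixl 6 _+_
  infixl 7 _*_
  infix  8 -_
  infix  9 _⁻¹
  field
    Carrier : Set
    _≤_     : Rel Carrier 0ℓ
    _+_ _*_ : Carrier → Carrier → Carrier
    -_      : Carrier → Carrier
    0# 1#   : Carrier
    _⁻¹     : Carrier → Carrier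
    sup     : Pred Carrier 0ℓ → Carrier

  _<_ : Rel Carrier 0ℓ
  x < y = x ≤ y × x ≢ y

  UpperBound : Pred Carrier 0ℓ → Pred Carrier 0ℓ
  UpperBound P b = ∀ x → P x → x ≤ b

  LeastUpperBound : Pred Carrier 0ℓ → Pred Carrier 0ℓ
  LeastUpperBound P s = UpperBound P s × (∀ b → UpperBound P b → s ≤ b)

  field
    isCommutativeRing : IsCommutativeRing _≡_ _+_ _*_ -_ 0# 1#
    isDecTotalOrder   : IsDecTotalOrder _≡_ _≤_
    0≢1               : 0# ≢ 1#
    *-inverseʳ        : ∀ x → x ≢ 0# → x * x ⁻¹ ≡ 1#
    +-monoˡ-≤         : ∀ x y z → x ≤ y → x + z ≤ y + z
    *-nonNegative     : ∀ x y → 0# ≤ x → 0# ≤ y → 0# ≤ x * y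
    -- The value of ⁻¹ at 0# and of sup on empty or unbounded sets is arbitrary.
    sup-lub           : ∀ P → ∃ P → ∃ (UpperBound P) → LeastUpperBound P (sup P)

  2# 4# : Carrier
  2# = 1# + 1#
  4# = 2# + 2#

  commutativeRing : CommutativeRing 0ℓ 0ℓ
  commutativeRing = record { isCommutativeRing = isCommutativeRing }

  totalOrder : TotalOrder 0ℓ 0ℓ 0ℓ
  totalOrder = record { isTotalOrder = IsDecTotalOrder.isTotalOrder isDecTotalOrder }

infixr 7 _⊗_
infixr 6 _⊕_

data Ty : Set where
  𝟙 real  : Ty
  _⊗_ _⊕_ : Ty → Ty → Ty
  list    : Ty → Ty

nat : Ty
nat = list 𝟙

-- A first-order language with exact real arithmetic, real constants, lists
-- and unbounded loops.  Every operation costs one step.  Two lists of reals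
-- form a tape, and conversely values can be kept as shared pointers on a
-- real-RAM with a polynomially bounded number of cells, so polynomial time
-- here is polynomial time in the unit-cost (Blum–Shub–Smale) model over the
-- ordered field of reals.
module Computation (ℝ : CompleteOrderedField) where
  open CompleteOrderedField ℝ

  ⟦_⟧ : Ty → Set
  ⟦ 𝟙 ⟧      = ⊤
  ⟦ real ⟧   = Carrier
  ⟦ A ⊗ B ⟧  = ⟦ A ⟧ × ⟦ B ⟧
  ⟦ A ⊕ B ⟧  = ⟦ A ⟧ ⊎ ⟦ B ⟧
  ⟦ list A ⟧ = List ⟦ A ⟧

  mutual
    size : ∀ A → ⟦ A ⟧ → ℕ
    size 𝟙        _        = 1
    size real     _        = 1
    size (A ⊗ B)  (a , b)  = suc (size A a ℕ.+ size B b)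
    size (A ⊕ B)  (inj₁ a) = suc (size A a)
    size (A ⊕ B)  (inj₂ b) = suc (size B b)
    size (list A) as       = sizes A as

    sizes : ∀ A → List ⟦ A ⟧ → ℕ
    sizes A []       = 1
    sizes A (a ∷ as) = suc (size A a ℕ.+ sizes A as)

  unary : ℕ → ⟦ nat ⟧
  unary n = List.replicate n tt

  data Term (Γ : List Ty) : Ty → Set where
    var      : ∀ {A} → A ∈ Γ → Term Γ A
    let′     : ∀ {A B} → Term Γ A → Term (A ∷ Γ) B → Term Γ B
    call     : ∀ {A B} → Term (A ∷ []) B → Term Γ A → Term Γ B
    unit     : Term Γ 𝟙
    pair     : ∀ {A B} → Term Γ A → Term Γ B → Term Γ (A ⊗ B)
    fst      : ∀ {A B} → Term Γ (A ⊗ B) → Term Γ A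
    snd      : ∀ {A B} → Term Γ (A ⊗ B) → Term Γ B
    inl      : ∀ {A B} → Term Γ A → Term Γ (A ⊕ B)
    inr      : ∀ {A B} → Term Γ B → Term Γ (A ⊕ B)
    case     : ∀ {A B C} → Term Γ (A ⊕ B) → Term (A ∷ Γ) C → Term (B ∷ Γ) C → Term Γ C
    nil      : ∀ {A} → Term Γ (list A)
    cons     : ∀ {A} → Term Γ A → Term Γ (list A) → Term Γ (list A)
    caseList : ∀ {A C} → Term Γ (list A) → Term Γ C → Term (A ∷ list A ∷ Γ) C → Term Γ C
    const    : Carrier → Term Γ real
    add mul  : Term Γ real → Term Γ real → Term Γ real
    neg inv  : Term Γ real → Term Γ real
    leq      : Term Γ real → Term Γ real → Term Γ (𝟙 ⊕ 𝟙)
    -- loop init body: replace the state a by a′ while body yields inj₁ a′,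
    -- return b as soon as it yields inj₂ b.
    loop     : ∀ {A B} → Term Γ A → Term (A ∷ Γ) (A ⊕ B) → Term Γ B

  Program : Ty → Ty → Set
  Program A B = Term (A ∷ []) B

  Env : List Ty → Set
  Env = All ⟦_⟧

  infix 4 _⊢_⇓_⟨_⟩ _⊢_from_⇓_⟨_⟩

  -- ρ ⊢ e ⇓ v ⟨ t ⟩: in environment ρ, e evaluates to v in t steps.
  mutual
    data _⊢_⇓_⟨_⟩ {Γ} (ρ : Env Γ) : ∀ {A} → Term Γ A → ⟦ A ⟧ → ℕ → Set where
      var      : ∀ {A} (x : A ∈ Γ) → ρ ⊢ var x ⇓ All.lookup ρ x ⟨ 1 ⟩
      let′     : ∀ {A B} {e : Term Γ A} {f : Term (A ∷ Γ) B} {a b s t} →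
                 ρ ⊢ e ⇓ a ⟨ s ⟩ → (a ∷ ρ) ⊢ f ⇓ b ⟨ t ⟩ →
                 ρ ⊢ let′ e f ⇓ b ⟨ suc (s ℕ.+ t) ⟩
      call     : ∀ {A B} {f : Program A B} {e : Term Γ A} {a b s t} →
                 ρ ⊢ e ⇓ a ⟨ s ⟩ → (a ∷ []) ⊢ f ⇓ b ⟨ t ⟩ →
                 ρ ⊢ call f e ⇓ b ⟨ suc (s ℕ.+ t) ⟩
      unit     : ρ ⊢ unit ⇓ tt ⟨ 1 ⟩
      pair     : ∀ {A B} {e : Term Γ A} {f : Term Γ B} {a b s t} →
                 ρ ⊢ e ⇓ a ⟨ s ⟩ → ρ ⊢ f ⇓ b ⟨ t ⟩ →
                 ρ ⊢ pair e f ⇓ (a , b) ⟨ suc (s ℕ.+ t) ⟩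
      fst      : ∀ {A B} {e : Term Γ (A ⊗ B)} {a b t} →
                 ρ ⊢ e ⇓ (a , b) ⟨ t ⟩ → ρ ⊢ fst e ⇓ a ⟨ suc t ⟩
      snd      : ∀ {A B} {e : Term Γ (A ⊗ B)} {a b t} →
                 ρ ⊢ e ⇓ (a , b) ⟨ t ⟩ → ρ ⊢ snd e ⇓ b ⟨ suc t ⟩
      inl      : ∀ {A B} {e : Term Γ A} {a t} →
                 ρ ⊢ e ⇓ a ⟨ t ⟩ → ρ ⊢ inl {B = B} e ⇓ inj₁ a ⟨ suc t ⟩
      inr      : ∀ {A B} {e : Term Γ B} {b t} →
                 ρ ⊢ e ⇓ b ⟨ t ⟩ → ρ ⊢ inr {A = A} e ⇓ inj₂ b ⟨ suc t ⟩
      case₁    : ∀ {A B C} {e : Term Γ (A ⊕ B)} {f : Term (A ∷ Γ) C} {g a c s t} →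
                 ρ ⊢ e ⇓ inj₁ a ⟨ s ⟩ → (a ∷ ρ) ⊢ f ⇓ c ⟨ t ⟩ →
                 ρ ⊢ case e f g ⇓ c ⟨ suc (s ℕ.+ t) ⟩
      case₂    : ∀ {A B C} {e : Term Γ (A ⊕ B)} {f} {g : Term (B ∷ Γ) C} {b c s t} →
                 ρ ⊢ e ⇓ inj₂ b ⟨ s ⟩ → (b ∷ ρ) ⊢ g ⇓ c ⟨ t ⟩ →
                 ρ ⊢ case e f g ⇓ c ⟨ suc (s ℕ.+ t) ⟩
      nil      : ∀ {A} → ρ ⊢ nil {A = A} ⇓ [] ⟨ 1 ⟩
      cons     : ∀ {A} {e : Term Γ A} {f : Term Γ (list A)} {a as s t} →
                 ρ ⊢ e ⇓ a ⟨ s ⟩ → ρ ⊢ f ⇓ as ⟨ t ⟩ →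
                 ρ ⊢ cons e f ⇓ (a ∷ as) ⟨ suc (s ℕ.+ t) ⟩
      caseNil  : ∀ {A C} {e : Term Γ (list A)} {f : Term Γ C} {g c s t} →
                 ρ ⊢ e ⇓ [] ⟨ s ⟩ → ρ ⊢ f ⇓ c ⟨ t ⟩ →
                 ρ ⊢ caseList e f g ⇓ c ⟨ suc (s ℕ.+ t) ⟩
      caseCons : ∀ {A C} {e : Term Γ (list A)} {f} {g : Term (A ∷ list A ∷ Γ) C} {a as c s t} →
                 ρ ⊢ e ⇓ (a ∷ as) ⟨ s ⟩ → (a ∷ as ∷ ρ) ⊢ g ⇓ c ⟨ t ⟩ →
                 ρ ⊢ caseList e f g ⇓ c ⟨ suc (s ℕ.+ t) ⟩
      const    : ∀ r → ρ ⊢ const r ⇓ r ⟨ 1 ⟩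
      add      : ∀ {e f x y s t} → ρ ⊢ e ⇓ x ⟨ s ⟩ → ρ ⊢ f ⇓ y ⟨ t ⟩ →
                 ρ ⊢ add e f ⇓ x + y ⟨ suc (s ℕ.+ t) ⟩
      mul      : ∀ {e f x y s t} → ρ ⊢ e ⇓ x ⟨ s ⟩ → ρ ⊢ f ⇓ y ⟨ t ⟩ →
                 ρ ⊢ mul e f ⇓ x * y ⟨ suc (s ℕ.+ t) ⟩
      neg      : ∀ {e x t} → ρ ⊢ e ⇓ x ⟨ t ⟩ → ρ ⊢ neg e ⇓ - x ⟨ suc t ⟩
      inv      : ∀ {e x t} → x ≢ 0# → ρ ⊢ e ⇓ x ⟨ t ⟩ → ρ ⊢ inv e ⇓ x ⁻¹ ⟨ suc t ⟩
      leq-yes  : ∀ {e f x y s t} → x ≤ y → ρ ⊢ e ⇓ x ⟨ s ⟩ → ρ ⊢ f ⇓ y ⟨ t ⟩ →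
                 ρ ⊢ leq e f ⇓ inj₁ tt ⟨ suc (s ℕ.+ t) ⟩
      leq-no   : ∀ {e f x y s t} → ¬ x ≤ y → ρ ⊢ e ⇓ x ⟨ s ⟩ → ρ ⊢ f ⇓ y ⟨ t ⟩ →
                 ρ ⊢ leq e f ⇓ inj₂ tt ⟨ suc (s ℕ.+ t) ⟩
      loop     : ∀ {A B} {e : Term Γ A} {f : Term (A ∷ Γ) (A ⊕ B)} {a b s t} →
                 ρ ⊢ e ⇓ a ⟨ s ⟩ → ρ ⊢ f from a ⇓ b ⟨ t ⟩ →
                 ρ ⊢ loop e f ⇓ b ⟨ suc (s ℕ.+ t) ⟩

    data _⊢_from_⇓_⟨_⟩ {Γ} (ρ : Env Γ) {A B} (f : Term (A ∷ Γ) (A ⊕ B)) :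
         ⟦ A ⟧ → ⟦ B ⟧ → ℕ → Set where
      done  : ∀ {a b t} → (a ∷ ρ) ⊢ f ⇓ inj₂ b ⟨ t ⟩ → ρ ⊢ f from a ⇓ b ⟨ suc t ⟩
      again : ∀ {a a′ b s t} → (a ∷ ρ) ⊢ f ⇓ inj₁ a′ ⟨ s ⟩ → ρ ⊢ f from a′ ⇓ b ⟨ t ⟩ →
              ρ ⊢ f from a ⇓ b ⟨ suc (s ℕ.+ t) ⟩

module Scheduling (ℝ : CompleteOrderedField) where
  open CompleteOrderedField ℝ
  open Computation ℝ
  open Max totalOrder using (_⊔_)
  open Min totalOrder using (_⊓_)
  open Sum (CommutativeRing.+-commutativeMonoid commutativeRing) using (sum)

  max min : ∀ {k} .{{_ : NonZero k}} → (Fin k → Carrier) → Carrier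
  max {suc _} f = Vec.foldr₁ _⊔_ (Vec.tabulate f)
  min {suc _} f = Vec.foldr₁ _⊓_ (Vec.tabulate f)

  Scenario : ℕ → Set
  Scenario n = Vec Carrier n

  -- An ordered partition of the jobs into m possibly empty parts, given by
  -- the index of the part containing each job.
  Schedule : ℕ → ℕ → Set
  Schedule m n = Fin n → Fin m

  part : ∀ {m n} → Schedule m n → Fin m → Subset n
  part σ i = Vec.tabulate (λ j → does (σ j ≟ i))

  load : ∀ {n} → Subset n → Scenario n → Carrier
  load S p = sum (λ j → if Vec.lookup S j then Vec.lookup p j else 0#)

  module _ {m n : ℕ} .{{_ : NonZero m}} where

    Cmax : Schedule m n → Scenario n → Carrier
    Cmax σ p = max (λ i → load (part σ i) p)

    worstCase : Schedule m n → Pred (Scenario n) 0ℓ → Carrier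
    worstCase σ U = sup (λ x → ∃ λ p → U p × x ≡ Cmax σ p)

  -- finToFun enumerates all m ^ n schedules.
  minSchedule : ∀ m n .{{_ : NonZero m}} → (Schedule m n → Carrier) → Carrier
  minSchedule m n f = min {m ℕ.^ n} {{m^n≢0 m n}} (λ k → f (finToFun k))

  OPT : ∀ m {n} .{{_ : NonZero m}} → Scenario n → Carrier
  OPT m {n} p = minSchedule m n (λ σ → Cmax σ p)

  OPTʳᵒᵇ : ∀ m {n} .{{_ : NonZero m}} → Pred (Scenario n) 0ℓ → Carrier
  OPTʳᵒᵇ m {n} U = minSchedule m n (λ σ → worstCase σ U)

  NonNegative : ∀ {n} → Scenario n → Set
  NonNegative p = ∀ j → 0# ≤ Vec.lookup p j

  Bounded : ∀ {n} → Pred (Scenario n) 0ℓ → Set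
  Bounded U = ∃ λ b → ∀ p → U p → ∀ j → Vec.lookup p j ≤ b

  -- Implicitly given uncertainty sets: an arbitrary decoding of input data
  -- into sets of scenarios, not assumed computable in any sense.
  record UncertaintyClass : Set₁ where
    field
      Code   : Ty
      decode : ∀ {n} → ⟦ Code ⟧ → Pred (Scenario n) 0ℓ

  record UncertaintySet (𝒰 : UncertaintyClass) (n : ℕ) : Set where
    open UncertaintyClass 𝒰
    field
      code : ⟦ Code ⟧

    scenarios : Pred (Scenario n) 0ℓ
    scenarios = decode code

    field
      nonNegative : ∀ p → scenarios p → NonNegative p
      nonEmpty    : ∃ scenarios
      bounded     : Bounded scenarios

  open UncertaintySet using (code; scenarios)

  encodeScenario : ∀ {n} → Scenario n → ⟦ list real ⟧
  encodeScenario = Vec.toList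

  encodeSchedule : ∀ {m n} → Schedule m n → ⟦ list nat ⟧
  encodeSchedule σ = List.tabulate (λ j → unary (toℕ (σ j)))

  -- One program for all numbers m ≥ 1 of machines and n of jobs, which on
  -- every instance x halts within c + c·(input size)ᵏ steps with a schedule
  -- that is good for x.  Writing out m parts takes m cells, hence m is
  -- counted in unary.
  PolyTimeScheduler : (A : Ty) (Instance : ℕ → Set) →
                      (∀ {n} → Instance n → ⟦ A ⟧) →
                      (∀ {m n} .{{_ : NonZero m}} → Instance n → Schedule m n → Set) → Set
  PolyTimeScheduler A Instance encode Good =
    Σ (Program (nat ⊗ nat ⊗ A) (list nat)) λ P →
    ∃ λ c → ∃ λ k →
    ∀ m n .{{_ : NonZero m}} (x : Instance n) →
    let input = unary m , unary n , encode x in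
    ∃ λ (σ : Schedule m n) → ∃ λ t →
      ((input ∷ []) ⊢ P ⇓ encodeSchedule σ ⟨ t ⟩) ×
      (t ℕ.≤ c ℕ.+ c ℕ.* size (nat ⊗ nat ⊗ A) input ℕ.^ k) ×
      Good x σ

  MakespanApproximation : Carrier → Set
  MakespanApproximation γ =
    PolyTimeScheduler (list real) (λ n → Σ (Scenario n) NonNegative)
      (λ (p , _) → encodeScenario p)
      (λ {m} (p , _) σ → Cmax σ p ≤ γ * OPT m p)

  RobustApproximation : UncertaintyClass → Carrier → Set
  RobustApproximation 𝒰 γ =
    PolyTimeScheduler (UncertaintyClass.Code 𝒰) (UncertaintySet 𝒰) code
      (λ {m} U σ → worstCase σ (scenarios U) ≤ γ * OPTʳᵒᵇ m (scenarios U))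

  LearningAugmented : UncertaintyClass → (consistency robustness : Carrier) → Set
  LearningAugmented 𝒰 α β =
    PolyTimeScheduler (UncertaintyClass.Code 𝒰 ⊗ list real)
      (λ n → Σ (UncertaintySet 𝒰 n) λ U → ∃ (scenarios U))
      (λ (U , p̂ , _) → code U , encodeScenario p̂)
      (λ {m} (U , p̂ , _) σ →
        Cmax σ p̂ ≤ α * OPT m p̂ ×
        worstCase σ (scenarios U) ≤ β * OPTʳᵒᵇ m (scenarios U))

{-# OPTIONS --safe #-}
module Submission where

-- Let N be the γ-approximate schedule for the prediction p̂, T its makespan, R the
-- robust schedule and s = T/λ (any s > 0 will do if T = 0).  Jobs longer than s stay
-- where N puts them.  The short jobs are distributed part by part of R, always onto
-- a current machine; once the amount assigned to it exceeds T + s, the least loaded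
-- machine becomes current.  Each part is charged an extra s when it is started, so
-- the total amount is at most m (T + s), the new current machine has at most T + s,
-- and no machine ends above T + 2s = T (1 + 2/λ), which is consistency.
-- Conversely every long job, and every part of R from which a machine takes short
-- jobs, accounts for at least s on that machine, except for one part, with which
-- the machine became current.  A machine thus meets at most (T + 2s)/s + 1 = λ + 3
-- parts of R, each of load at most the worst case of R, and λ + 3 ≤ 2λ + 4.

-- The charge `s` is what makes the parts countable: a part whose short jobs are tiny under the
-- prediction can be as heavy as any other under another scenario, so predicted loads alone would
-- let one machine absorb arbitrarily many parts. There are as many parts as machines, hence the
-- charges cost each machine only `s` on average, which is the room that `cap = T + s` leaves above
-- `T`. A machine is given up only above `cap` and never taken up again, so it meets an uncharged
-- part at most once. The algorithm sees only `p̂`, yet its schedule must be good for all scenarios.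
-- One run is therefore analysed against an arbitrary second scenario `q`, of which only
-- non-negativity and the bound `B` on the parts of `R` are used. Counting parts takes the form
-- `s * load ≤ B * amount`, free of division and rounding. For the running time, the algorithm is
-- written as an ordinary function on finite vectors; combinators that mirror its definition yield a
-- program together with its correctness and a polynomial step bound.

open import Defs

open import Algebra.Bundles using (CommutativeRing)
import Algebra.Construct.NaturalChoice.Max as Max
import Algebra.Properties.Ring as RingProperties
import Algebra.Properties.Semiring.Sum as Sum
import Algebra.Solver.Ring.NaturalCoefficients.Default as Solver
open import Data.Bool.Base using (Bool; true; false; if_then_else_; _∧_)
open import Data.Fin.Base using (Fin; zero; suc; toℕ; inject₁; fromℕ; combine)
open import Data.Fin.Properties
  using (_≟_; suc-injective; toℕ-injective; toℕ<n; toℕ-inject₁; toℕ-fromℕ; toℕ-combine; combine-injective)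
open import Data.List.Base as List using (List; []; _∷_; _++_)
open import Data.List.Membership.Propositional using (_∈_)
open import Data.List.Properties using (++-identityʳ)
open import Data.List.Relation.Unary.All as All using ([]; _∷_)
open import Data.List.Relation.Unary.Any using (here; there)
open import Data.Nat.Base as ℕ using (ℕ; zero; suc; NonZero; s≤s; z≤n)
import Data.Nat.Properties as ℕ
open import Data.Nat.Solver using (module +-*-Solver)
open import Data.Product.Base using (∃; _×_; _,_; proj₁; proj₂)
open import Data.Sum.Base using (_⊎_; inj₁; inj₂; map)
open import Data.Unit.Base using (⊤; tt)
open import Data.Vec.Base as Vec using ([]; _∷_)
open import Data.Vec.Properties using (lookup∘tabulate)
open import Function.Base using (_∘_; id)
open import Relation.Binary.Definitions using (tri<; tri≈; tri>)
open import Relation.Binary.PropositionalEquality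
open import Relation.Binary.Structures using (IsDecTotalOrder)
open import Relation.Nullary using (¬_; Dec; does; yes; no; contradiction)
open import Relation.Nullary.Decidable using (dec-true; dec-false)

-- Polynomial cost bounds

data Poly : Set where
  con     : ℕ → Poly
  𝑋       : Poly
  _⊞_ _⊠_ : Poly → Poly → Poly

infixr 6 _⊞_
infixr 7 _⊠_

eval : Poly → ℕ → ℕ
eval (con c) N = c
eval 𝑋       N = N
eval (P ⊞ Q) N = eval P N ℕ.+ eval Q N
eval (P ⊠ Q) N = eval P N ℕ.* eval Q N

-- A single monomial dominates the whole polynomial at every positive argument. There a larger
-- exponent does no harm, so a sum may be given the sum of the degrees instead of their maximum.
coefficient degree : Poly → ℕ
coefficient (con c) = c
coefficient 𝑋       = 1
coefficient (P ⊞ Q) = coefficient P ℕ.+ coefficient Q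
coefficient (P ⊠ Q) = coefficient P ℕ.* coefficient Q
degree (con c) = 0
degree 𝑋       = 1
degree (P ⊞ Q) = degree P ℕ.+ degree Q
degree (P ⊠ Q) = degree P ℕ.+ degree Q

^-monoʳ-≤-+ˡ : ∀ N .{{_ : NonZero N}} k l → N ℕ.^ k ℕ.≤ N ℕ.^ (k ℕ.+ l)
^-monoʳ-≤-+ˡ N k l = ℕ.^-monoʳ-≤ N (ℕ.m≤m+n k l)

^-monoʳ-≤-+ʳ : ∀ N .{{_ : NonZero N}} k l → N ℕ.^ l ℕ.≤ N ℕ.^ (k ℕ.+ l)
^-monoʳ-≤-+ʳ N k l = ℕ.^-monoʳ-≤ N (ℕ.m≤n+m l k)

eval-bound : ∀ P N .{{_ : NonZero N}} → eval P N ℕ.≤ coefficient P ℕ.* N ℕ.^ degree P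
eval-bound (con c) N = ℕ.≤-reflexive (sym (ℕ.*-identityʳ c))
eval-bound 𝑋       N = ℕ.≤-reflexive (sym (trans (ℕ.*-identityˡ _) (ℕ.*-identityʳ N)))
eval-bound (P ⊞ Q) N = begin
  eval P N ℕ.+ eval Q N             ≤⟨ ℕ.+-mono-≤ (eval-bound P N) (eval-bound Q N) ⟩
  p ℕ.* N ℕ.^ k ℕ.+ q ℕ.* N ℕ.^ l   ≤⟨ ℕ.+-mono-≤ (ℕ.*-monoʳ-≤ p (^-monoʳ-≤-+ˡ N k l))
                                                  (ℕ.*-monoʳ-≤ q (^-monoʳ-≤-+ʳ N k l)) ⟩
  p ℕ.* N ℕ.^ (k ℕ.+ l) ℕ.+ q ℕ.* N ℕ.^ (k ℕ.+ l) ≡⟨ ℕ.*-distribʳ-+ _ p q ⟨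
  (p ℕ.+ q) ℕ.* N ℕ.^ (k ℕ.+ l)     ∎
  where
  open ℕ.≤-Reasoning
  p = coefficient P
  q = coefficient Q
  k = degree P
  l = degree Q
eval-bound (P ⊠ Q) N = begin
  eval P N ℕ.* eval Q N               ≤⟨ ℕ.*-mono-≤ (eval-bound P N) (eval-bound Q N) ⟩
  (p ℕ.* N ℕ.^ k) ℕ.* (q ℕ.* N ℕ.^ l) ≡⟨ ℕ.[m*n]*[o*p]≡[m*o]*[n*p] p (N ℕ.^ k) q (N ℕ.^ l) ⟩
  (p ℕ.* q) ℕ.* (N ℕ.^ k ℕ.* N ℕ.^ l) ≡⟨ cong (p ℕ.* q ℕ.*_) (ℕ.^-distribˡ-+-* N k l) ⟨
  (p ℕ.* q) ℕ.* N ℕ.^ (k ℕ.+ l)       ∎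
  where
  open ℕ.≤-Reasoning
  p = coefficient P
  q = coefficient Q
  k = degree P
  l = degree Q

-- `K` stands for the cost of passing arguments, `x` and `y` for the running times of the two
-- assumed algorithms, and `z` for that of merging their schedules.
polynomial-sum : ∀ K {S} a {x} k b {y} l c {z} r → 1 ℕ.≤ S →
  x ℕ.≤ a ℕ.+ a ℕ.* S ℕ.^ k → y ℕ.≤ b ℕ.+ b ℕ.* S ℕ.^ l → z ℕ.≤ c ℕ.* S ℕ.^ r →
  K ℕ.+ x ℕ.+ y ℕ.+ z ℕ.≤ (K ℕ.+ a ℕ.+ b ℕ.+ c) ℕ.+ (K ℕ.+ a ℕ.+ b ℕ.+ c) ℕ.* S ℕ.^ (k ℕ.+ l ℕ.+ r)
polynomial-sum K {S@(suc _)} a {x} k b {y} l c {z} r 1≤S x≤ y≤ z≤ = begin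
  K ℕ.+ x ℕ.+ y ℕ.+ z
    ≤⟨ ℕ.+-mono-≤ (ℕ.+-mono-≤ (ℕ.+-monoʳ-≤ K (ℕ.≤-trans x≤ (ℕ.+-monoʳ-≤ a (ℕ.*-monoʳ-≤ a (up k≤)))))
         (ℕ.≤-trans y≤ (ℕ.+-monoʳ-≤ b (ℕ.*-monoʳ-≤ b (up l≤)))))
         (ℕ.≤-trans z≤ (ℕ.*-monoʳ-≤ c (up (ℕ.m≤n+m r (k ℕ.+ l))))) ⟩
  K ℕ.+ (a ℕ.+ a ℕ.* P) ℕ.+ (b ℕ.+ b ℕ.* P) ℕ.+ c ℕ.* P
    ≤⟨ ℕ.m≤n+m _ (c ℕ.+ K ℕ.* P) ⟩
  c ℕ.+ K ℕ.* P ℕ.+ (K ℕ.+ (a ℕ.+ a ℕ.* P) ℕ.+ (b ℕ.+ b ℕ.* P) ℕ.+ c ℕ.* P)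
    ≡⟨ solve 5 (λ K a b c P → c :+ K :* P :+ (K :+ (a :+ a :* P) :+ (b :+ b :* P) :+ c :* P) :=
         (K :+ a :+ b :+ c) :+ (K :+ a :+ b :+ c) :* P) refl K a b c P ⟩
  (K ℕ.+ a ℕ.+ b ℕ.+ c) ℕ.+ (K ℕ.+ a ℕ.+ b ℕ.+ c) ℕ.* P ∎
  where
  open ℕ.≤-Reasoning
  open +-*-Solver
  P = S ℕ.^ (k ℕ.+ l ℕ.+ r)
  up : ∀ {k′} → k′ ℕ.≤ k ℕ.+ l ℕ.+ r → S ℕ.^ k′ ℕ.≤ P
  up = ℕ.^-monoʳ-≤ S
  k≤ : k ℕ.≤ k ℕ.+ l ℕ.+ r
  k≤ = ℕ.≤-trans (ℕ.m≤m+n k l) (ℕ.m≤m+n (k ℕ.+ l) r)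
  l≤ : l ℕ.≤ k ℕ.+ l ℕ.+ r
  l≤ = ℕ.≤-trans (ℕ.m≤n+m l k) (ℕ.m≤m+n (k ℕ.+ l) r)

-- The left side is the step count that the evaluation rules produce for `combinedProgram`; 38 is
-- what it spends outside the three programs that it calls.
time-regroup : ∀ x y z → 26 ℕ.+ (x ℕ.+ (12 ℕ.+ y) ℕ.+ z) ≡ 38 ℕ.+ x ℕ.+ y ℕ.+ z
time-regroup = solve 3 (λ x y z → con 26 :+ (x :+ (con 12 :+ y) :+ z) := con 38 :+ x :+ y :+ z) refl
  where open +-*-Solver

-- Loops over Fin d and updates

foldDown : ∀ {X : Set} d → (Fin d → X → X) → X → X
foldDown zero    g x = x
foldDown (suc d) g x = foldDown d (g ∘ inject₁) (g (fromℕ d) x)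

-- The last index is visited first, so consing restores the original order.
foldDown-tabulate : ∀ {X : Set} d (f : Fin d → X) xs →
                    foldDown d (λ j → f j ∷_) xs ≡ List.tabulate f ++ xs
foldDown-tabulate zero    f xs = refl
foldDown-tabulate (suc d) f xs = trans (foldDown-tabulate d (f ∘ inject₁) _) (snoc d f)
  where
  snoc : ∀ d (f : Fin (suc d) → _) →
         List.tabulate (f ∘ inject₁) ++ f (fromℕ d) ∷ xs ≡ List.tabulate f ++ xs
  snoc zero    f = refl
  snoc (suc d) f = cong (f zero ∷_) (snoc d (f ∘ suc))

-- The index of `P` is the number of iterations still to run, a natural number, so that the states
-- before and after the loop have one too.
foldDown-invariant : ∀ {X : Set} (P : ℕ → X → Set) d (g : Fin d → X → X) {x} →
                     (∀ j x → P (suc (toℕ j)) x → P (toℕ j) (g j x)) →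
                     P d x → P 0 (foldDown d g x)
foldDown-invariant P zero    g step base = base
foldDown-invariant P (suc d) g {x₀} step base =
  foldDown-invariant P d (g ∘ inject₁)
    (λ j x Px → subst (λ k → P k (g (inject₁ j) x)) (toℕ-inject₁ j)
      (step (inject₁ j) x (subst (λ k → P (suc k) x) (sym (toℕ-inject₁ j)) Px)))
    (subst (λ k → P k (g (fromℕ d) x₀)) (toℕ-fromℕ d)
      (step (fromℕ d) x₀ (subst (λ k → P (suc k) x₀) (sym (toℕ-fromℕ d)) base)))

update : ∀ {X : Set} {d} → Fin d → X → (Fin d → X) → Fin d → X
update i x f j = if does (j ≟ i) then x else f j

update-updates : ∀ {X : Set} {d} i {x : X} {f : Fin d → X} → update i x f i ≡ x
update-updates i {x} {f} = cong (if_then x else f i) (dec-true (i ≟ i) refl)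

update-minimal : ∀ {X : Set} {d} i {x : X} {f : Fin d → X} j → j ≢ i → update i x f j ≡ f j
update-minimal i {x} {f} j j≢i = cong (if_then x else f j) (dec-false (j ≟ i) j≢i)

-- Compilation of functions on finite vectors to programs

data Dim : Set where
  machines jobs : Dim

infixr 7 _⊗ᵗ_

-- `dim d` has one value, encoded as the length of `d` in unary: it supplies programs with loop
-- bounds.
data Type : Set where
  bool real : Type
  dim fin   : Dim → Type
  vec       : Dim → Type → Type
  _⊗ᵗ_      : Type → Type → Type

-- (m , n) stands for suc m machines and n jobs.
Shape : Set
Shape = ℕ × ℕ

∣_∣ : Dim → Shape → ℕ
∣ machines ∣ (m , n) = suc m
∣ jobs     ∣ (m , n) = n

scale : Shape → ℕ
scale (m , n) = suc m ℕ.+ n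

∣∣≤scale : ∀ d z → ∣ d ∣ z ℕ.≤ scale z
∣∣≤scale machines (m , n) = ℕ.m≤m+n (suc m) n
∣∣≤scale jobs     (m , n) = ℕ.m≤n+m n (suc m)

module Compilation (ℝ : CompleteOrderedField) where
  open CompleteOrderedField ℝ
  open Computation ℝ
  open IsDecTotalOrder isDecTotalOrder using (_≤?_)

  Val : Type → Shape → Set
  Val bool     z = Bool
  Val real     z = Carrier
  Val (dim d)  z = ⊤
  Val (fin d)  z = Fin (∣ d ∣ z)
  Val (vec d A) z = Fin (∣ d ∣ z) → Val A z
  Val (A ⊗ᵗ B)  z = Val A z × Val B z

  ⌜_⌝ : Type → Ty
  ⌜ bool ⌝    = 𝟙 ⊕ 𝟙
  ⌜ real ⌝    = real
  ⌜ dim d ⌝   = nat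
  ⌜ fin d ⌝   = nat
  ⌜ vec d A ⌝ = list ⌜ A ⌝
  ⌜ A ⊗ᵗ B ⌝  = ⌜ A ⌝ ⊗ ⌜ B ⌝

  encodeBool : Bool → ⟦ 𝟙 ⊕ 𝟙 ⟧
  encodeBool true  = inj₁ tt
  encodeBool false = inj₂ tt

  encode : ∀ A z → Val A z → ⟦ ⌜ A ⌝ ⟧
  encode bool      z b       = encodeBool b
  encode real      z x       = x
  encode (dim d)   z _       = unary (∣ d ∣ z)
  encode (fin d)   z i       = unary (toℕ i)
  encode (vec d A) z f       = List.tabulate (λ i → encode A z (f i))
  encode (A ⊗ᵗ B)  z (x , y) = encode A z x , encode B z y

  -- Evaluation within a step bound, and loops over unary counters

  infix 4 _⊢_⇓_≤⟨_⟩ _⊢_from_⇓_≤⟨_⟩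

  _⊢_⇓_≤⟨_⟩ : ∀ {Γ A} → Env Γ → Term Γ A → ⟦ A ⟧ → ℕ → Set
  ρ ⊢ e ⇓ v ≤⟨ b ⟩ = ∃ λ t → (ρ ⊢ e ⇓ v ⟨ t ⟩) × t ℕ.≤ b

  _⊢_from_⇓_≤⟨_⟩ : ∀ {Γ A B} → Env Γ → Term (A ∷ Γ) (A ⊕ B) → ⟦ A ⟧ → ⟦ B ⟧ → ℕ → Set
  ρ ⊢ f from a ⇓ v ≤⟨ b ⟩ = ∃ λ t → (ρ ⊢ f from a ⇓ v ⟨ t ⟩) × t ℕ.≤ b

  raise₁ : ∀ {X Y : ℕ → Set} {a} → (∀ {s} → X s → Y (suc s)) →
           (∃ λ s → X s × s ℕ.≤ a) → ∃ λ t → Y t × t ℕ.≤ suc a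
  raise₁ f (s , x , s≤a) = suc s , f x , s≤s s≤a

  raise₂ : ∀ {X Y Z : ℕ → Set} {a b} → (∀ {s t} → X s → Y t → Z (suc (s ℕ.+ t))) →
           (∃ λ s → X s × s ℕ.≤ a) → (∃ λ t → Y t × t ℕ.≤ b) →
           ∃ λ t → Z t × t ℕ.≤ suc (a ℕ.+ b)
  raise₂ f (s , x , s≤a) (t , y , t≤b) = suc (s ℕ.+ t) , f x y , s≤s (ℕ.+-mono-≤ s≤a t≤b)

  relax : ∀ {X : ℕ → Set} {a b} → a ℕ.≤ b → (∃ λ s → X s × s ℕ.≤ a) → ∃ λ s → X s × s ℕ.≤ b
  relax a≤b (s , x , s≤a) = s , x , ℕ.≤-trans s≤a a≤b

  var≤ : ∀ {Γ A} {ρ : Env Γ} (x : A ∈ Γ) → ρ ⊢ var x ⇓ All.lookup ρ x ≤⟨ 1 ⟩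
  var≤ x = 1 , var x , ℕ.≤-refl

  nil≤ : ∀ {Γ A} {ρ : Env Γ} → ρ ⊢ nil {A = A} ⇓ [] ≤⟨ 1 ⟩
  nil≤ = 1 , nil , ℕ.≤-refl

  pair≤ : ∀ {Γ A B} {ρ : Env Γ} {e : Term Γ A} {f : Term Γ B} {u v a b} →
          ρ ⊢ e ⇓ u ≤⟨ a ⟩ → ρ ⊢ f ⇓ v ≤⟨ b ⟩ → ρ ⊢ pair e f ⇓ (u , v) ≤⟨ suc (a ℕ.+ b) ⟩
  pair≤ = raise₂ pair

  call≤ : ∀ {Γ A B} {ρ : Env Γ} {f : Program A B} {e : Term Γ A} {u v a b} →
          ρ ⊢ e ⇓ u ≤⟨ a ⟩ → (u ∷ []) ⊢ f ⇓ v ≤⟨ b ⟩ → ρ ⊢ call f e ⇓ v ≤⟨ suc (a ℕ.+ b) ⟩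
  call≤ = raise₂ call

  loop≤ : ∀ {Γ A B} {ρ : Env Γ} {e : Term Γ A} {f : Term (A ∷ Γ) (A ⊕ B)} {u v a b} →
          ρ ⊢ e ⇓ u ≤⟨ a ⟩ → ρ ⊢ f from u ⇓ v ≤⟨ b ⟩ → ρ ⊢ loop e f ⇓ v ≤⟨ suc (a ℕ.+ b) ⟩
  loop≤ = raise₂ loop

  v₀ : ∀ {Γ A} → Term (A ∷ Γ) A
  v₀ = var (here refl)

  v₁ : ∀ {Γ A B} → Term (A ∷ B ∷ Γ) B
  v₁ = var (there (here refl))

  v₂ : ∀ {Γ A B C} → Term (A ∷ B ∷ C ∷ Γ) C
  v₂ = var (there (there (here refl)))

  v₃ : ∀ {Γ A B C D} → Term (A ∷ B ∷ C ∷ D ∷ Γ) D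
  v₃ = var (there (there (there (here refl))))

  downwardBody : ∀ {S G} → Program (nat ⊗ S ⊗ G) S →
                 Term ((nat ⊗ S ⊗ G) ∷ (nat ⊗ S ⊗ G) ∷ []) ((nat ⊗ S ⊗ G) ⊕ S)
  downwardBody body =
    caseList (fst v₀) (inr (fst (snd v₀)))
      (inl (pair v₁ (pair (call body (pair v₁ (snd v₂))) (snd (snd v₂)))))

  -- The tail of unary (suc i) is unary i, so counting down produces the
  -- indices themselves.
  downward : ∀ {S G} → Program (nat ⊗ S ⊗ G) S → Program (nat ⊗ S ⊗ G) S
  downward body = loop v₀ (downwardBody body)

  -- The loop state encodes an element of an arbitrary `X`, so the lemma serves both folds over
  -- values of a `Type` and the building of a list.
  downward-correct : ∀ {S G} {X : Set} (⌞_⌟ : X → ⟦ S ⟧) (body : Program (nat ⊗ S ⊗ G) S)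
    {ρ : Env ((nat ⊗ S ⊗ G) ∷ [])} {γ : ⟦ G ⟧} {b} d (g : Fin d → X → X) →
    (∀ j x → (unary (toℕ j) , ⌞ x ⌟ , γ) ∷ [] ⊢ body ⇓ ⌞ g j x ⌟ ≤⟨ b ⟩) → ∀ x →
    ρ ⊢ downwardBody body from (unary d , ⌞ x ⌟ , γ) ⇓ ⌞ foldDown d g x ⌟ ≤⟨ d ℕ.* (16 ℕ.+ b) ℕ.+ 9 ⟩
  downward-correct ⌞_⌟ body zero g h x =
    _ , done (caseNil (fst (var _)) (inr (fst (snd (var _))))) , ℕ.m≤m+n _ _
  downward-correct ⌞_⌟ body {ρ} {γ} {b} (suc d) g h x
    with t , D , t≤b ← subst (λ k → (unary k , ⌞ x ⌟ , γ) ∷ [] ⊢ body ⇓ ⌞ g (fromℕ d) x ⌟ ≤⟨ b ⟩)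
                             (toℕ-fromℕ d) (h (fromℕ d) x)
    with u , E , u≤ ← downward-correct ⌞_⌟ body {ρ} d (g ∘ inject₁)
           (λ j x → subst (λ k → (unary k , ⌞ x ⌟ , γ) ∷ [] ⊢ body ⇓ ⌞ g (inject₁ j) x ⌟ ≤⟨ b ⟩)
                          (toℕ-inject₁ j) (h (inject₁ j) x)) (g (fromℕ d) x) =
    _ , again (caseCons (fst (var _))
          (inl (pair (var _) (pair (call (pair (var _) (snd (var _))) D) (snd (snd (var _))))))) E
      , bound
    where
    open ℕ.≤-Reasoning
    bound : 13 ℕ.+ (t ℕ.+ 3 ℕ.+ u) ℕ.≤ (16 ℕ.+ b ℕ.+ d ℕ.* (16 ℕ.+ b)) ℕ.+ 9
    bound = begin
      13 ℕ.+ (t ℕ.+ 3 ℕ.+ u)                           ≡⟨ cong (λ r → 13 ℕ.+ (r ℕ.+ u)) (ℕ.+-comm t 3) ⟩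
      16 ℕ.+ t ℕ.+ u                                   ≤⟨ ℕ.+-mono-≤ (ℕ.+-monoʳ-≤ 16 t≤b) u≤ ⟩
      16 ℕ.+ b ℕ.+ (d ℕ.* (16 ℕ.+ b) ℕ.+ 9)            ≡⟨ ℕ.+-assoc (16 ℕ.+ b) _ 9 ⟨
      (16 ℕ.+ b ℕ.+ d ℕ.* (16 ℕ.+ b)) ℕ.+ 9            ∎

  lookupBody : ∀ {A} → Term ((list A ⊗ nat) ∷ (list A ⊗ nat) ∷ []) ((list A ⊗ nat) ⊕ A)
  -- No element of `A` is available when the list is empty, so this branch repeats the state
  -- forever; an index in `Fin d` never reaches it.
  lookupBody = caseList (fst v₀) (inl v₀) (caseList (snd v₂) (inr v₀) (inl (pair v₃ v₁)))

  lookupProgram : ∀ {A} → Program (list A ⊗ nat) A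
  lookupProgram = loop v₀ lookupBody

  lookup-correct : ∀ {A ρ} d (f : Fin d → ⟦ A ⟧) i →
    ρ ⊢ lookupBody {A} from (List.tabulate f , unary (toℕ i)) ⇓ f i ≤⟨ d ℕ.* 11 ⟩
  lookup-correct (suc d) f zero =
    _ , done (caseCons (fst (var _)) (caseNil (snd (var _)) (inr (var _)))) ,
    ℕ.≤-trans (ℕ.m≤m+n 9 2) (ℕ.m≤m+n 11 _)
  lookup-correct {A} {ρ} (suc d) f (suc i)
    with u , E , u≤ ← lookup-correct {A} {ρ} d (f ∘ suc) i =
    _ , again (caseCons (fst (var _)) (caseCons (snd (var _)) (inl (pair (var _) (var _))))) E ,
    ℕ.+-monoʳ-≤ 11 u≤

  equalBody : Term ((nat ⊗ nat) ∷ (nat ⊗ nat) ∷ []) ((nat ⊗ nat) ⊕ (𝟙 ⊕ 𝟙))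
  equalBody =
    caseList (fst v₀)
      (caseList (snd v₀) (inr (inl unit)) (inr (inr unit)))
      (caseList (snd v₂) (inr (inr unit)) (inl (pair v₃ v₁)))

  equalProgram : Program (nat ⊗ nat) (𝟙 ⊕ 𝟙)
  equalProgram = loop v₀ equalBody

  equal-correct : ∀ {ρ} d (i j : Fin d) →
    ρ ⊢ equalBody from (unary (toℕ i) , unary (toℕ j)) ⇓ encodeBool (does (i ≟ j)) ≤⟨ d ℕ.* 11 ⟩
  equal-correct (suc d) zero zero =
    _ , done (caseNil (fst (var _)) (caseNil (snd (var _)) (inr (inl unit)))) ,
    ℕ.≤-trans (ℕ.m≤m+n 10 1) (ℕ.m≤m+n 11 _)
  equal-correct (suc d) zero (suc j) =
    _ , done (caseNil (fst (var _)) (caseCons (snd (var _)) (inr (inr unit)))) ,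
    ℕ.≤-trans (ℕ.m≤m+n 10 1) (ℕ.m≤m+n 11 _)
  equal-correct (suc d) (suc i) zero =
    _ , done (caseCons (fst (var _)) (caseNil (snd (var _)) (inr (inr unit)))) ,
    ℕ.≤-trans (ℕ.m≤m+n 10 1) (ℕ.m≤m+n 11 _)
  equal-correct {ρ} (suc d) (suc i) (suc j)
    with u , E , u≤ ← equal-correct {ρ} d i j =
    _ , again (caseCons (fst (var _)) (caseCons (snd (var _)) (inl (pair (var _) (var _))))) E ,
    ℕ.+-monoʳ-≤ 11 u≤

  -- The program has its whole context as a single input, so composing programs by `call` needs no
  -- weakening or substitution. The shape bounds the length of every value of a `Type`, so
  -- intermediate results cannot grow, and costs, as polynomials in `scale z`, add up under
  -- composition.
  record Computable {A B} (f : ∀ z → Val A z → Val B z) : Set where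
    constructor computable
    field
      program : Program ⌜ A ⌝ ⌜ B ⌝
      cost    : Poly
      correct : ∀ z x → (encode A z x ∷ []) ⊢ program ⇓ encode B z (f z x) ≤⟨ eval cost (scale z) ⟩

  open Computable

  inputᶜ : ∀ {Γ} → Computable {Γ} {Γ} (λ z x → x)
  inputᶜ = computable v₀ (con 1) λ z x → var≤ _

  fstᶜ : ∀ {Γ A B} {f : ∀ z → Val Γ z → Val (A ⊗ᵗ B) z} →
         Computable {Γ} {A ⊗ᵗ B} f → Computable {Γ} {A} (λ z x → proj₁ (f z x))
  fstᶜ F = computable (fst (F .program)) (con 1 ⊞ F .cost)
    λ z x → raise₁ fst (F .correct z x)

  sndᶜ : ∀ {Γ A B} {f : ∀ z → Val Γ z → Val (A ⊗ᵗ B) z} →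
         Computable {Γ} {A ⊗ᵗ B} f → Computable {Γ} {B} (λ z x → proj₂ (f z x))
  sndᶜ F = computable (snd (F .program)) (con 1 ⊞ F .cost)
    λ z x → raise₁ snd (F .correct z x)

  infixr 4 _,ᶜ_

  _,ᶜ_ : ∀ {Γ A B} {f : ∀ z → Val Γ z → Val A z} {g : ∀ z → Val Γ z → Val B z} →
         Computable {Γ} {A} f → Computable {Γ} {B} g →
         Computable {Γ} {A ⊗ᵗ B} (λ z x → f z x , g z x)
  F ,ᶜ G = computable (pair (F .program) (G .program)) (con 1 ⊞ F .cost ⊞ G .cost)
    λ z x → pair≤ (F .correct z x) (G .correct z x)

  x₀ : ∀ {A Γ} → Computable {A ⊗ᵗ Γ} {A} (λ z → proj₁)
  x₀ = fstᶜ inputᶜ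

  x₁ : ∀ {A B Γ} → Computable {A ⊗ᵗ B ⊗ᵗ Γ} {B} (λ z x → proj₁ (proj₂ x))
  x₁ = fstᶜ (sndᶜ inputᶜ)

  x₂ : ∀ {A B C Γ} → Computable {A ⊗ᵗ B ⊗ᵗ C ⊗ᵗ Γ} {C} (λ z x → proj₁ (proj₂ (proj₂ x)))
  x₂ = fstᶜ (sndᶜ (sndᶜ inputᶜ))

  constᶜ : ∀ {Γ} r → Computable {Γ} {real} (λ z x → r)
  constᶜ r = computable (const r) (con 1) λ z x → _ , const r , ℕ.≤-refl

  zeroᶜ : ∀ {Γ} → Computable {Γ} {fin machines} (λ z x → zero)
  zeroᶜ = computable nil (con 1) λ z x → nil≤

  _+ᶜ_ : ∀ {Γ} {f g : ∀ z → Val Γ z → Carrier} →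
         Computable {Γ} {real} f → Computable {Γ} {real} g →
         Computable {Γ} {real} (λ z x → f z x + g z x)
  F +ᶜ G = computable (add (F .program) (G .program)) (con 1 ⊞ F .cost ⊞ G .cost)
    λ z x → raise₂ add (F .correct z x) (G .correct z x)

  _*ᶜ_ : ∀ {Γ} {f g : ∀ z → Val Γ z → Carrier} →
         Computable {Γ} {real} f → Computable {Γ} {real} g →
         Computable {Γ} {real} (λ z x → f z x * g z x)
  F *ᶜ G = computable (mul (F .program) (G .program)) (con 1 ⊞ F .cost ⊞ G .cost)
    λ z x → raise₂ mul (F .correct z x) (G .correct z x)

  _≤?ᶜ_ : ∀ {Γ} {f g : ∀ z → Val Γ z → Carrier} →
          Computable {Γ} {real} f → Computable {Γ} {real} g →
          Computable {Γ} {bool} (λ z x → does (f z x ≤? g z x))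
  _≤?ᶜ_ {Γ} {f} {g} F G = computable (leq (F .program) (G .program)) (con 1 ⊞ F .cost ⊞ G .cost) ok
    where
    ok : ∀ z x → (encode Γ z x ∷ []) ⊢ leq (F .program) (G .program) ⇓ encodeBool (does (f z x ≤? g z x))
                   ≤⟨ suc (eval (F .cost ⊞ G .cost) (scale z)) ⟩
    ok z x with f z x ≤? g z x
    ... | yes p = raise₂ (leq-yes p) (F .correct z x) (G .correct z x)
    ... | no ¬p = raise₂ (leq-no ¬p) (F .correct z x) (G .correct z x)

  ifᶜ_then_else_ : ∀ {Γ A} {c : ∀ z → Val Γ z → Bool} {f g : ∀ z → Val Γ z → Val A z} →
                   Computable {Γ} {bool} c → Computable {Γ} {A} f → Computable {Γ} {A} g →
                   Computable {Γ} {A} (λ z x → if c z x then f z x else g z x)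
  ifᶜ_then_else_ {Γ} {A} {c} {f} {g} C F G = computable prog
    -- Both branches are paid for, which replaces a maximum.
    (con 1 ⊞ C .cost ⊞ con 2 ⊞ F .cost ⊞ G .cost) ok
    where
    prog = case (C .program) (call (F .program) v₁) (call (G .program) v₁)
    ok : ∀ z x → (encode Γ z x ∷ []) ⊢ prog ⇓ encode A z (if c z x then f z x else g z x)
                   ≤⟨ suc (eval (C .cost ⊞ con 2 ⊞ F .cost ⊞ G .cost) (scale z)) ⟩
    ok z x with c z x | C .correct z x
    ... | true  | C↓ = raise₂ case₁ C↓
      (relax (s≤s (s≤s (ℕ.m≤m+n _ _))) (call≤ (var≤ _) (F .correct z x)))
    ... | false | C↓ = raise₂ case₂ C↓
      (relax (s≤s (s≤s (ℕ.m≤n+m _ _))) (call≤ (var≤ _) (G .correct z x)))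

  infixr 5 letᶜ_inᶜ_

  letᶜ_inᶜ_ : ∀ {Γ A B} {f : ∀ z → Val Γ z → Val A z} {g : ∀ z → Val (A ⊗ᵗ Γ) z → Val B z} →
              Computable {Γ} {A} f → Computable {A ⊗ᵗ Γ} {B} g →
              Computable {Γ} {B} (λ z x → g z (f z x , x))
  letᶜ F inᶜ G = computable (call (G .program) (pair (F .program) v₀))
    (con 1 ⊞ (con 1 ⊞ F .cost ⊞ con 1) ⊞ G .cost)
    λ z x → call≤ (pair≤ (F .correct z x) (var≤ _)) (G .correct z _)

  scale-bound : ∀ d z k → ∣ d ∣ z ℕ.* k ℕ.≤ scale z ℕ.* k
  scale-bound d z k = ℕ.*-monoˡ-≤ k (∣∣≤scale d z)

  _!ᶜ_ : ∀ {Γ d A} {f : ∀ z → Val Γ z → Val (vec d A) z} {i : ∀ z → Val Γ z → Val (fin d) z} →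
         Computable {Γ} {vec d A} f → Computable {Γ} {fin d} i →
         Computable {Γ} {A} (λ z x → f z x (i z x))
  _!ᶜ_ {d = d} {A} F I = computable (call lookupProgram (pair (F .program) (I .program)))
    (con 1 ⊞ (con 1 ⊞ F .cost ⊞ I .cost) ⊞ con 1 ⊞ con 1 ⊞ 𝑋 ⊠ con 11)
    λ z x → call≤ (pair≤ (F .correct z x) (I .correct z x))
      (loop≤ (var≤ _) (relax (scale-bound d z 11) (lookup-correct {⌜ A ⌝} _ _ _)))

  _≟ᶜ_ : ∀ {Γ d} {i j : ∀ z → Val Γ z → Val (fin d) z} →
         Computable {Γ} {fin d} i → Computable {Γ} {fin d} j →
         Computable {Γ} {bool} (λ z x → does (i z x ≟ j z x))
  _≟ᶜ_ {d = d} I J = computable (call equalProgram (pair (I .program) (J .program)))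
    (con 1 ⊞ (con 1 ⊞ I .cost ⊞ J .cost) ⊞ con 1 ⊞ con 1 ⊞ 𝑋 ⊠ con 11)
    λ z x → call≤ (pair≤ (I .correct z x) (J .correct z x))
      (loop≤ (var≤ _) (relax (scale-bound d z 11) (equal-correct _ _ _)))

  foldᶜ : ∀ {Γ d S} {h : ∀ z → Val Γ z → ⊤} {s : ∀ z → Val Γ z → Val S z}
          {g : ∀ z → Val (fin d ⊗ᵗ S ⊗ᵗ Γ) z → Val S z} →
          Computable {Γ} {dim d} h → Computable {Γ} {S} s → Computable {fin d ⊗ᵗ S ⊗ᵗ Γ} {S} g →
          Computable {Γ} {S} (λ z x → foldDown (∣ d ∣ z) (λ j y → g z (j , y , x)) (s z x))
  foldᶜ {d = d} {S} H S₀ G = computable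
    (call (downward (G .program)) (pair (H .program) (pair (S₀ .program) v₀)))
    (con 1 ⊞ (con 1 ⊞ H .cost ⊞ con 1 ⊞ S₀ .cost ⊞ con 1) ⊞ con 1 ⊞ con 1 ⊞ 𝑋 ⊠ (con 16 ⊞ G .cost) ⊞ con 9)
    λ z x → call≤
      (pair≤ (H .correct z x) (pair≤ (S₀ .correct z x) (var≤ _)))
      (loop≤ (var≤ _)
        (relax (ℕ.+-monoˡ-≤ 9 (scale-bound d z _))
          (downward-correct (encode S z) (G .program) (∣ d ∣ z) _ (λ j y → G .correct z (j , y , x)) _)))

  -- The list under construction changes its length and is thus no value of `vec d A`, so `foldᶜ`
  -- does not apply; the underlying loop is used directly.
  tabulateᶜ : ∀ {Γ d A} {h : ∀ z → Val Γ z → ⊤} {g : ∀ z → Val (fin d ⊗ᵗ Γ) z → Val A z} →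
              Computable {Γ} {dim d} h → Computable {fin d ⊗ᵗ Γ} {A} g →
              Computable {Γ} {vec d A} (λ z x j → g z (j , x))
  tabulateᶜ {Γ} {d} {A} {g = g} H G = computable
    (call (downward prog) (pair (H .program) (pair nil v₀)))
    total ok
    where
    total = con 1 ⊞ (con 1 ⊞ H .cost ⊞ con 3) ⊞ con 1 ⊞ con 1 ⊞ 𝑋 ⊠ (con 16 ⊞ G .cost ⊞ con 11) ⊞ con 9
    prog : Program (nat ⊗ list ⌜ A ⌝ ⊗ ⌜ Γ ⌝) (list ⌜ A ⌝)
    prog = cons (call (G .program) (pair (fst v₀) (snd (snd v₀)))) (fst (snd v₀))
    ok : ∀ z x → _ ⊢ _ ⇓ encode (vec d A) z (λ j → g z (j , x)) ≤⟨ eval total (scale z) ⟩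
    ok z x = call≤
      (pair≤ (H .correct z x) (pair≤ nil≤ (var≤ _)))
      (loop≤ (var≤ _)
        (relax (ℕ.+-monoˡ-≤ 9 (scale-bound d z _))
          (subst (λ as → _ ⊢ downwardBody prog from _ ⇓ as ≤⟨ _ ⟩)
            (trans (foldDown-tabulate (∣ d ∣ z) _ []) (++-identityʳ _))
            (downward-correct id prog (∣ d ∣ z) (λ j → encode A z (g z (j , x)) ∷_) step []))))
      where
      step : ∀ j as → (unary (toℕ j) , as , encode Γ z x) ∷ [] ⊢ prog ⇓ encode A z (g z (j , x)) ∷ as
                        ≤⟨ eval (G .cost ⊞ con 11) (scale z) ⟩
      step j as with t , D , t≤ ← G .correct z (j , x) =
        _ , cons (call (pair (fst (var _)) (snd (snd (var _)))) D) (fst (snd (var _))) ,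
        ℕ.≤-trans (ℕ.≤-reflexive (cong (8 ℕ.+_) (ℕ.+-comm t 3)))
          (ℕ.≤-trans (ℕ.+-monoʳ-≤ 11 t≤) (ℕ.≤-reflexive (ℕ.+-comm 11 _)))

-- The combination algorithm

module Algorithm (ℝ : CompleteOrderedField) where
  open CompleteOrderedField ℝ
  open Computation ℝ
  open IsDecTotalOrder isDecTotalOrder using (_≤?_)
  open Compilation ℝ
  open Computable

  _∘ᶜ_ : ∀ {A B C} {g : ∀ z → Val B z → Val C z} {f : ∀ z → Val A z → Val B z} →
         Computable {B} {C} g → Computable {A} {B} f → Computable {A} {C} (λ z x → g z (f z x))
  G ∘ᶜ F = computable (call (G .program) (F .program)) (con 1 ⊞ F .cost ⊞ G .cost)
    λ z x → call≤ (F .correct z x) (G .correct z _)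

  supremum : ∀ d → (Fin d → Carrier) → Carrier
  supremum d V = foldDown d (λ i t → if does (V i ≤? t) then t else V i) 0#

  argmin : ∀ d → Fin d → (Fin d → Carrier) → Fin d
  argmin d c V = foldDown d (λ i c → if does (V i ≤? V c) then i else c) c

  loadOf : ∀ {m} n → (Fin n → Fin m) → (Fin n → Carrier) → Fin m → Carrier
  loadOf n σ w i = foldDown n (λ j t → if does (σ j ≟ i) then w j + t else t) 0#

  threshold : Carrier → Carrier → Carrier
  threshold κ T = if does (T ≤? 0#) then 1# else T * κ

  bigOnly : ∀ {n} → Carrier → (Fin n → Carrier) → Fin n → Carrier
  bigOnly s p j = if does (p j ≤? s) then 0# else p j

  pick : ∀ d → Carrier → Fin d × (Fin d → Carrier) → Fin d
  pick d cap (c , V) = if does (V c ≤? cap) then c else argmin d c V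

  put : ∀ d → Carrier → Carrier → Fin d × (Fin d → Carrier) → Fin d × (Fin d → Carrier)
  put d cap x (c , V) =
    let i = pick d cap (c , V) in i , update i (V i + x) V

  State : ℕ → ℕ → Set
  State d n = (Fin n → Fin d) × Fin d × (Fin d → Carrier)

  assign : ∀ d {n} → Carrier → Carrier → Fin n → State d n → State d n
  assign d cap x j (σ , cV) =
    let cV′ = put d cap x cV in update j (proj₁ cV′) σ , cV′

  module _ (d : ℕ) {n : ℕ} (s cap : Carrier) (p : Fin n → Carrier) (R : Fin n → Fin d) where

    place : Fin d → Fin n → State d n → State d n
    place k j S =
      if does (p j ≤? s) then (if does (R j ≟ k) then assign d cap (p j) j S else S) else S

    processPart : Fin d → State d n → State d n
    processPart k (σ , cV) = foldDown n (place k) (σ , put d cap s cV)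

  -- Starting from `N` leaves the long jobs in place, while each short job is overwritten when its
  -- turn comes. The initial amounts count long jobs only, and the first current machine `zero` is
  -- an arbitrary choice.
  merge : ∀ m {n} → Carrier → (Fin n → Carrier) → (N R : Fin n → Fin (suc m)) → Fin n → Fin (suc m)
  merge m {n} κ p N R =
    let T = supremum (suc m) (loadOf n N p)
        s = threshold κ T
    in proj₁ (foldDown (suc m) (processPart (suc m) s (T + s) p R)
                (N , zero , loadOf n N (bigOnly s p)))

  -- Programs for the steps of the algorithm

  Computes : ∀ A B → (∀ z → Val A z → Val B z) → Set
  Computes A B = Computable {A} {B}

  supremumᶜ : Computes (dim machines ⊗ᵗ vec machines real) real
                (λ z (_ , V) → supremum (∣ machines ∣ z) V)
  supremumᶜ = foldᶜ x₀ (constᶜ 0#)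
    (let V = sndᶜ (sndᶜ (sndᶜ inputᶜ)) in
     ifᶜ (V !ᶜ x₀) ≤?ᶜ x₁ then x₁ else (V !ᶜ x₀))

  argminᶜ : Computes (dim machines ⊗ᵗ fin machines ⊗ᵗ vec machines real) (fin machines)
              (λ z (_ , c , V) → argmin (∣ machines ∣ z) c V)
  argminᶜ = foldᶜ x₀ x₁
    (let V = sndᶜ (sndᶜ (sndᶜ (sndᶜ inputᶜ))) in
     ifᶜ (V !ᶜ x₀) ≤?ᶜ (V !ᶜ x₁) then x₀ else x₁)

  loadOfᶜ : Computes (dim machines ⊗ᵗ dim jobs ⊗ᵗ vec jobs (fin machines) ⊗ᵗ vec jobs real) (vec machines real)
              (λ z (_ , _ , σ , w) → loadOf (∣ jobs ∣ z) σ w)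
  loadOfᶜ = tabulateᶜ x₀ (foldᶜ x₂ (constᶜ 0#)
    (let i = x₂
         σ = fstᶜ (sndᶜ (sndᶜ (sndᶜ (sndᶜ (sndᶜ inputᶜ)))))
         w = sndᶜ (sndᶜ (sndᶜ (sndᶜ (sndᶜ (sndᶜ inputᶜ))))) in
     ifᶜ (σ !ᶜ x₀) ≟ᶜ i then ((w !ᶜ x₀) +ᶜ x₁) else x₁))

  updateᶜ : ∀ {d A} → Computes (dim d ⊗ᵗ fin d ⊗ᵗ A ⊗ᵗ vec d A) (vec d A)
              (λ z (_ , i , x , f) → update i x f)
  updateᶜ = tabulateᶜ x₀
    (ifᶜ x₀ ≟ᶜ x₂ then fstᶜ (sndᶜ (sndᶜ (sndᶜ inputᶜ))) else (sndᶜ (sndᶜ (sndᶜ (sndᶜ inputᶜ))) !ᶜ x₀))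

  putᶜ : Computes (dim machines ⊗ᵗ real ⊗ᵗ real ⊗ᵗ fin machines ⊗ᵗ vec machines real)
           (fin machines ⊗ᵗ vec machines real)
           (λ z (_ , cap , x , cV) → put (∣ machines ∣ z) cap x cV)
  putᶜ =
    letᶜ (let c = fstᶜ (sndᶜ (sndᶜ (sndᶜ inputᶜ)))
              V = sndᶜ (sndᶜ (sndᶜ (sndᶜ inputᶜ))) in
          ifᶜ (V !ᶜ c) ≤?ᶜ x₁ then c else (argminᶜ ∘ᶜ (x₀ ,ᶜ c ,ᶜ V)))
    inᶜ (let x = fstᶜ (sndᶜ (sndᶜ (sndᶜ inputᶜ)))
             V = sndᶜ (sndᶜ (sndᶜ (sndᶜ (sndᶜ inputᶜ)))) in
         x₀ ,ᶜ (updateᶜ ∘ᶜ (x₁ ,ᶜ x₀ ,ᶜ ((V !ᶜ x₀) +ᶜ x) ,ᶜ V)))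

  cursorᵗ stateᵗ : Type
  cursorᵗ = fin machines ⊗ᵗ vec machines real
  stateᵗ  = vec jobs (fin machines) ⊗ᵗ cursorᵗ

  assignᶜ : Computes (dim machines ⊗ᵗ dim jobs ⊗ᵗ real ⊗ᵗ real ⊗ᵗ fin jobs ⊗ᵗ stateᵗ) stateᵗ
              (λ z (_ , _ , cap , x , j , S) → assign (∣ machines ∣ z) cap x j S)
  assignᶜ =
    letᶜ putᶜ ∘ᶜ (x₀ ,ᶜ x₂ ,ᶜ fstᶜ (sndᶜ (sndᶜ (sndᶜ inputᶜ))) ,ᶜ sndᶜ (sndᶜ (sndᶜ (sndᶜ (sndᶜ (sndᶜ inputᶜ))))))
    inᶜ ((updateᶜ ∘ᶜ (x₂ ,ᶜ fstᶜ (sndᶜ (sndᶜ (sndᶜ (sndᶜ (sndᶜ inputᶜ))))) ,ᶜ fstᶜ x₀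
           ,ᶜ fstᶜ (sndᶜ (sndᶜ (sndᶜ (sndᶜ (sndᶜ (sndᶜ inputᶜ))))))))
         ,ᶜ x₀)

  inputᵗ : Type
  inputᵗ = dim machines ⊗ᵗ dim jobs ⊗ᵗ real ⊗ᵗ real ⊗ᵗ vec jobs real ⊗ᵗ vec jobs (fin machines)

  placeᶜ : Computes (fin machines ⊗ᵗ fin jobs ⊗ᵗ stateᵗ ⊗ᵗ inputᵗ) stateᵗ
             (λ z (k , j , S , _ , _ , s , cap , p , R) → place (∣ machines ∣ z) s cap p R k j S)
  placeᶜ =
    let k = x₀
        j = x₁
        S = x₂
        I = sndᶜ (sndᶜ (sndᶜ inputᶜ))
        M = fstᶜ I
        J = fstᶜ (sndᶜ I)
        s = fstᶜ (sndᶜ (sndᶜ I))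
        cap = fstᶜ (sndᶜ (sndᶜ (sndᶜ I)))
        p = fstᶜ (sndᶜ (sndᶜ (sndᶜ (sndᶜ I))))
        R = sndᶜ (sndᶜ (sndᶜ (sndᶜ (sndᶜ I))))
    in ifᶜ (p !ᶜ j) ≤?ᶜ s
       then (ifᶜ (R !ᶜ j) ≟ᶜ k then (assignᶜ ∘ᶜ (M ,ᶜ J ,ᶜ cap ,ᶜ (p !ᶜ j) ,ᶜ j ,ᶜ S)) else S)
       else S

  processPartᶜ : Computes (fin machines ⊗ᵗ stateᵗ ⊗ᵗ inputᵗ) stateᵗ
                   (λ z (k , S , _ , _ , s , cap , p , R) → processPart (∣ machines ∣ z) s cap p R k S)
  processPartᶜ =
    let S = x₁
        I = sndᶜ (sndᶜ inputᶜ)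
        M = fstᶜ I
        J = fstᶜ (sndᶜ I)
        s = fstᶜ (sndᶜ (sndᶜ I))
        cap = fstᶜ (sndᶜ (sndᶜ (sndᶜ I)))
    in foldᶜ J (fstᶜ S ,ᶜ (putᶜ ∘ᶜ (M ,ᶜ cap ,ᶜ s ,ᶜ sndᶜ S)))
         (placeᶜ ∘ᶜ (x₂ ,ᶜ x₀ ,ᶜ x₁ ,ᶜ sndᶜ (sndᶜ (sndᶜ (sndᶜ inputᶜ)))))

  nextPartᶜ : Computes (fin machines ⊗ᵗ stateᵗ ⊗ᵗ stateᵗ ⊗ᵗ inputᵗ) stateᵗ
                (λ z (k , S , _ , _ , _ , s , cap , p , R) → processPart (∣ machines ∣ z) s cap p R k S)
  nextPartᶜ = processPartᶜ ∘ᶜ (x₀ ,ᶜ x₁ ,ᶜ sndᶜ (sndᶜ (sndᶜ inputᶜ)))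

  scheduleᶜ : Computes (stateᵗ ⊗ᵗ inputᵗ) (vec jobs (fin machines))
                (λ z (S , _ , _ , s , cap , p , R) →
                   proj₁ (foldDown (∣ machines ∣ z) (processPart (∣ machines ∣ z) s cap p R) S))
  scheduleᶜ = fstᶜ (foldᶜ x₁ x₀ nextPartᶜ)

  bigOnlyᶜ : Computes (dim jobs ⊗ᵗ real ⊗ᵗ vec jobs real) (vec jobs real)
               (λ z (_ , s , p) → bigOnly s p)
  bigOnlyᶜ = tabulateᶜ x₀
    (let p = sndᶜ (sndᶜ (sndᶜ inputᶜ)) in
     ifᶜ (p !ᶜ x₀) ≤?ᶜ x₂ then constᶜ 0# else (p !ᶜ x₀))

  schedulesᵗ : Type
  schedulesᵗ = dim machines ⊗ᵗ dim jobs ⊗ᵗ vec jobs real ⊗ᵗ vec jobs (fin machines) ⊗ᵗ vec jobs (fin machines)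

  bigLoadᶜ : Computes (real ⊗ᵗ real ⊗ᵗ schedulesᵗ) (vec machines real)
               (λ z (s , _ , _ , _ , p , N , _) → loadOf (∣ jobs ∣ z) N (bigOnly s p))
  bigLoadᶜ =
    let J = fstᶜ (sndᶜ (sndᶜ (sndᶜ inputᶜ)))
        p = fstᶜ (sndᶜ (sndᶜ (sndᶜ (sndᶜ inputᶜ))))
        N = fstᶜ (sndᶜ (sndᶜ (sndᶜ (sndᶜ (sndᶜ inputᶜ)))))
    in loadOfᶜ ∘ᶜ (x₂ ,ᶜ J ,ᶜ N ,ᶜ (bigOnlyᶜ ∘ᶜ (J ,ᶜ x₀ ,ᶜ p)))

  -- The factor `κ`, later `λ′ ⁻¹`, is compiled in as a real constant, so no division is executed.
  mergeᶜ : ∀ κ → Computes schedulesᵗ (vec jobs (fin machines))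
                   (λ z (_ , _ , p , N , R) → merge (proj₁ z) κ p N R)
  mergeᶜ κ =
    letᶜ supremumᶜ ∘ᶜ (x₀ ,ᶜ (loadOfᶜ ∘ᶜ (x₀ ,ᶜ x₁ ,ᶜ fstᶜ (sndᶜ (sndᶜ (sndᶜ inputᶜ))) ,ᶜ x₂)))
    inᶜ letᶜ (ifᶜ x₀ ≤?ᶜ constᶜ 0# then constᶜ 1# else (x₀ *ᶜ constᶜ κ))
    inᶜ (let s = x₀
             T = x₁
             M = x₂
             J = fstᶜ (sndᶜ (sndᶜ (sndᶜ inputᶜ)))
             p = fstᶜ (sndᶜ (sndᶜ (sndᶜ (sndᶜ inputᶜ))))
             N = fstᶜ (sndᶜ (sndᶜ (sndᶜ (sndᶜ (sndᶜ inputᶜ)))))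
             R = sndᶜ (sndᶜ (sndᶜ (sndᶜ (sndᶜ (sndᶜ inputᶜ)))))
         in scheduleᶜ ∘ᶜ ((N ,ᶜ zeroᶜ ,ᶜ bigLoadᶜ)
                          ,ᶜ M ,ᶜ J ,ᶜ s ,ᶜ (T +ᶜ s) ,ᶜ p ,ᶜ R))

-- Ordered fields and finite sums

module FieldProperties (ℝ : CompleteOrderedField) where
  open CompleteOrderedField ℝ
  open CommutativeRing commutativeRing public
    using (+-identityˡ; +-identityʳ; +-assoc; +-comm; -‿inverseʳ; -‿inverseˡ; zeroʳ
          ; *-assoc; *-comm; *-identityˡ; *-identityʳ; distribˡ; commutativeSemiring; semiring; ring)
  open IsDecTotalOrder isDecTotalOrder public
    using (_≤?_)
    renaming (refl to ≤-refl; trans to ≤-trans; antisym to ≤-antisym; total to ≤-total; reflexive to ≤-reflexive)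
  open RingProperties ring using (-‿distribˡ-*; -‿involutive)
  open Sum semiring public
    using (sum; sum-cong-≗; sum-init-last; ∑-distrib-+; ∑-comm; *-distribˡ-sum; sum-replicate-zero)
  open Solver commutativeSemiring public using (solve; _:+_; _:*_; _:=_)

  +-mono-≤ : ∀ {a b c d} → a ≤ b → c ≤ d → a + c ≤ b + d
  +-mono-≤ {a} {b} {c} {d} a≤b c≤d = ≤-trans (+-monoˡ-≤ a b c a≤b)
    (subst₂ _≤_ (+-comm c b) (+-comm d b) (+-monoˡ-≤ c d b c≤d))

  +-monoʳ-≤ : ∀ a {b c} → b ≤ c → a + b ≤ a + c
  +-monoʳ-≤ a = +-mono-≤ ≤-refl

  x+y-y≡x : ∀ x y → x + y + - y ≡ x
  x+y-y≡x x y = trans (+-assoc x y (- y)) (trans (cong (x +_) (-‿inverseʳ y)) (+-identityʳ x))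

  x-y+y≡x : ∀ x y → x + - y + y ≡ x
  x-y+y≡x x y = trans (+-assoc x (- y) y) (trans (cong (x +_) (-‿inverseˡ y)) (+-identityʳ x))

  +-cancelʳ-≤ : ∀ {a b} c → a + c ≤ b + c → a ≤ b
  +-cancelʳ-≤ {a} {b} c ac≤bc =
    subst₂ _≤_ (x+y-y≡x a c) (x+y-y≡x b c) (+-monoˡ-≤ _ _ (- c) ac≤bc)

  x≤x+y : ∀ x {y} → 0# ≤ y → x ≤ x + y
  x≤x+y x 0≤y = subst₂ _≤_ (+-identityʳ x) refl (+-monoʳ-≤ x 0≤y)

  +-nonNegative : ∀ {x y} → 0# ≤ x → 0# ≤ y → 0# ≤ x + y
  +-nonNegative 0≤x 0≤y = ≤-trans 0≤x (x≤x+y _ 0≤y)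

  *-monoˡ-≤ : ∀ {c} → 0# ≤ c → ∀ {a b} → a ≤ b → c * a ≤ c * b
  *-monoˡ-≤ {c} 0≤c {a} {b} a≤b = subst₂ _≤_ (+-identityˡ _)
    (trans (sym (distribˡ c (b + - a) a)) (cong (c *_) (x-y+y≡x b a)))
    (+-monoˡ-≤ _ _ (c * a) (*-nonNegative c (b + - a) 0≤c 0≤b-a))
    where
    0≤b-a : 0# ≤ b + - a
    0≤b-a = subst (_≤ b + - a) (-‿inverseʳ a) (+-monoˡ-≤ a b (- a) a≤b)

  *-monoʳ-≤ : ∀ {c} → 0# ≤ c → ∀ {a b} → a ≤ b → a * c ≤ b * c
  *-monoʳ-≤ 0≤c a≤b = subst₂ _≤_ (*-comm _ _) (*-comm _ _) (*-monoˡ-≤ 0≤c a≤b)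

  0≤1 : 0# ≤ 1#
  0≤1 with ≤-total 0# 1#
  ... | inj₁ 0≤1 = 0≤1
  ... | inj₂ 1≤0 = subst (0# ≤_) -1*-1≡1 (*-nonNegative (- 1#) (- 1#) 0≤-1 0≤-1)
    where
    0≤-1 : 0# ≤ - 1#
    0≤-1 = subst₂ _≤_ (-‿inverseʳ 1#) (+-identityˡ _) (+-monoˡ-≤ 1# 0# (- 1#) 1≤0)
    -1*-1≡1 : - 1# * - 1# ≡ 1#
    -1*-1≡1 = trans (sym (-‿distribˡ-* 1# (- 1#)))
      (trans (cong -_ (*-identityˡ (- 1#))) (-‿involutive 1#))

  ≰⇒≥ : ∀ {x y} → ¬ x ≤ y → y ≤ x
  ≰⇒≥ {x} {y} x≰y with ≤-total x y
  ... | inj₁ x≤y = contradiction x≤y x≰y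
  ... | inj₂ y≤x = y≤x

  -- In the case `b ≤ a` the two products coincide, and multiplying by `c ⁻¹` gives equality; the
  -- sign of the inverse does not enter.
  *-cancelˡ-≤ : ∀ {c} → 0# < c → ∀ {a b} → c * a ≤ c * b → a ≤ b
  *-cancelˡ-≤ {c} (0≤c , 0≢c) {a} {b} ca≤cb with ≤-total a b
  ... | inj₁ a≤b = a≤b
  ... | inj₂ b≤a = ≤-reflexive (trans (sym (undo a)) (trans (cong (c ⁻¹ *_) ca≡cb) (undo b)))
    where
    ca≡cb : c * a ≡ c * b
    ca≡cb = ≤-antisym ca≤cb (*-monoˡ-≤ 0≤c b≤a)
    undo : ∀ x → c ⁻¹ * (c * x) ≡ x
    undo x = trans (sym (*-assoc _ _ _)) (trans (cong (_* x)
      (trans (*-comm _ _) (*-inverseʳ c (0≢c ∘ sym)))) (*-identityˡ x))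

  ⁻¹-nonNegative : ∀ {x} → 0# < x → 0# ≤ x ⁻¹
  ⁻¹-nonNegative {x} (0≤x , 0≢x) with ≤-total 0# (x ⁻¹)
  ... | inj₁ 0≤x⁻¹ = 0≤x⁻¹
  ... | inj₂ x⁻¹≤0 = contradiction (≤-antisym 0≤1 1≤0) 0≢1
    where
    1≤0 : 1# ≤ 0#
    1≤0 = subst₂ _≤_ (*-inverseʳ x (0≢x ∘ sym)) (zeroʳ x) (*-monoˡ-≤ 0≤x x⁻¹≤0)

  if-nonNegative : ∀ b {x} → 0# ≤ x → 0# ≤ (if b then x else 0#)
  if-nonNegative true  0≤x = 0≤x
  if-nonNegative false 0≤x = ≤-refl

  if-≤ : ∀ b {x} → 0# ≤ x → (if b then x else 0#) ≤ x
  if-≤ true  0≤x = ≤-refl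
  if-≤ false 0≤x = 0≤x

  sum-mono-≤ : ∀ {n} {f g : Fin n → Carrier} → (∀ i → f i ≤ g i) → sum f ≤ sum g
  sum-mono-≤ {zero}  f≤g = ≤-refl
  sum-mono-≤ {suc n} f≤g = +-mono-≤ (f≤g zero) (sum-mono-≤ (f≤g ∘ suc))

  sum-nonNegative : ∀ {n} {f : Fin n → Carrier} → (∀ i → 0# ≤ f i) → 0# ≤ sum f
  sum-nonNegative {n} 0≤f = subst₂ _≤_ (sum-replicate-zero n) refl (sum-mono-≤ 0≤f)

  term≤sum : ∀ {n} {f : Fin n → Carrier} → (∀ i → 0# ≤ f i) → ∀ j → f j ≤ sum f
  term≤sum 0≤f zero    = x≤x+y _ (sum-nonNegative (0≤f ∘ suc))
  term≤sum 0≤f (suc j) = ≤-trans (term≤sum (0≤f ∘ suc) j)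
    (subst₂ _≤_ (+-identityˡ _) refl (+-monoˡ-≤ _ _ _ (0≤f zero)))

  -- The corrections `x` and `y` stand on both sides to avoid subtraction. This covers raising one
  -- amount, moving one job and removing one job.
  sum-change : ∀ {n} {f g : Fin n → Carrier} j {x y} → f j + x ≡ g j + y →
               (∀ i → i ≢ j → f i ≡ g i) → sum f + x ≡ sum g + y
  sum-change {f = f} {g} zero {x} {y} fg f≡g = begin
    f zero + sum (f ∘ suc) + x ≡⟨ swap (f zero) _ x ⟩
    f zero + x + sum (f ∘ suc) ≡⟨ cong₂ _+_ fg (sum-cong-≗ (λ i → f≡g (suc i) λ ())) ⟩
    g zero + y + sum (g ∘ suc) ≡⟨ swap (g zero) _ y ⟨
    g zero + sum (g ∘ suc) + y ∎
    where
    open ≡-Reasoning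
    swap = solve 3 (λ a b c → a :+ b :+ c := a :+ c :+ b) refl
  sum-change {f = f} {g} (suc j) fg f≡g = trans (+-assoc _ _ _) (trans
    (cong₂ _+_ (f≡g zero λ ()) (sum-change j fg (λ i i≢j → f≡g (suc i) (i≢j ∘ suc-injective))))
    (sym (+-assoc _ _ _)))

  -- If `y ≤ x`, the remaining terms compare the other way and can be cancelled, so multiples by
  -- natural numbers need not be divided.
  sum-const-cancel-≤ : ∀ n {x y} → sum {suc n} (λ _ → x) ≤ sum {suc n} (λ _ → y) → x ≤ y
  sum-const-cancel-≤ n {x} {y} nx≤ny with ≤-total x y
  ... | inj₁ x≤y = x≤y
  ... | inj₂ y≤x = +-cancelʳ-≤ (sum {n} (λ _ → y))
    (≤-trans (+-monoʳ-≤ x (sum-mono-≤ {n} (λ _ → y≤x))) nx≤ny)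

  indicator-sum : ∀ {m} (k : Fin m) x → sum (λ i → if does (k ≟ i) then x else 0#) ≡ x
  indicator-sum {suc m} zero    x = trans (cong (x +_) (sum-replicate-zero m)) (+-identityʳ x)
  indicator-sum {suc m} (suc k) x = trans (+-identityˡ _) (indicator-sum k x)

  -- Loads of machines

  machineLoad : ∀ {m n} → (Fin n → Fin m) → (Fin n → Carrier) → Fin m → Carrier
  machineLoad σ w i = sum (λ j → if does (σ j ≟ i) then w j else 0#)

  sum-machineLoad : ∀ {m n} (σ : Fin n → Fin m) w → sum (machineLoad σ w) ≡ sum w
  sum-machineLoad σ w = trans (∑-comm (λ i j → if does (σ j ≟ i) then w j else 0#))
    (sum-cong-≗ (λ j → indicator-sum (σ j) (w j)))

  machineLoad-nonNegative : ∀ {m n} (σ : Fin n → Fin m) {w} → (∀ j → 0# ≤ w j) → ∀ i → 0# ≤ machineLoad σ w i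
  machineLoad-nonNegative σ 0≤w i = sum-nonNegative (λ j → if-nonNegative (does (σ j ≟ i)) (0≤w j))

  if-mono-≤ : ∀ b {x y} → x ≤ y → (if b then x else 0#) ≤ (if b then y else 0#)
  if-mono-≤ true  x≤y = x≤y
  if-mono-≤ false x≤y = ≤-refl

  machineLoad-mono-≤ : ∀ {m n} (σ : Fin n → Fin m) {v w} → (∀ j → v j ≤ w j) →
                       ∀ i → machineLoad σ v i ≤ machineLoad σ w i
  machineLoad-mono-≤ σ v≤w i = sum-mono-≤ (λ j → if-mono-≤ (does (σ j ≟ i)) (v≤w j))

  machineLoad-cong : ∀ {m n} (σ : Fin n → Fin m) {v w} → (∀ j → v j ≡ w j) →
                     ∀ i → machineLoad σ v i ≡ machineLoad σ w i
  machineLoad-cong σ v≡w i = sum-cong-≗ (λ j → cong (if does (σ j ≟ i) then_else 0#) (v≡w j))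

  *-machineLoad : ∀ {m n} (σ : Fin n → Fin m) c w i → c * machineLoad σ w i ≡ machineLoad σ (λ j → c * w j) i
  *-machineLoad σ c w i = trans (*-distribˡ-sum c (λ j → if does (σ j ≟ i) then w j else 0#))
    (sum-cong-≗ λ j → *-if (does (σ j ≟ i)) (w j))
    where
    *-if : ∀ b x → c * (if b then x else 0#) ≡ (if b then c * x else 0#)
    *-if true  x = refl
    *-if false x = zeroʳ c

  weight≤machineLoad : ∀ {m n} (σ : Fin n → Fin m) {w} → (∀ j → 0# ≤ w j) → ∀ j → w j ≤ machineLoad σ w (σ j)
  weight≤machineLoad σ {w} 0≤w j =
    subst (_≤ machineLoad σ w (σ j)) (cong (if_then w j else 0#) (dec-true (σ j ≟ σ j) refl))
      (term≤sum {f = λ l → if does (σ l ≟ σ j) then w l else 0#}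
        (λ l → if-nonNegative (does (σ l ≟ σ j)) (0≤w l)) j)

-- Load invariants of the algorithm

module Balancing (ℝ : CompleteOrderedField) where
  open CompleteOrderedField ℝ
  open FieldProperties ℝ
  open Algorithm ℝ

  supremum-nonNegative : ∀ d V → 0# ≤ supremum d V
  supremum-nonNegative d V = foldDown-invariant (λ _ → 0# ≤_) d _ step ≤-refl
    where
    step : ∀ i t → 0# ≤ t → 0# ≤ (if does (V i ≤? t) then t else V i)
    step i t 0≤t with V i ≤? t
    ... | yes _   = 0≤t
    ... | no Vi≰t = ≤-trans 0≤t (≰⇒≥ Vi≰t)

  supremum-upper : ∀ d V i → V i ≤ supremum d V
  supremum-upper d V i = foldDown-invariant (λ κ t → ∀ i → κ ℕ.≤ toℕ i → V i ≤ t) d _ step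
    (λ i d≤i → contradiction d≤i (ℕ.<⇒≱ (toℕ<n i))) i z≤n
    where
    step : ∀ k t → (∀ i → toℕ k ℕ.< toℕ i → V i ≤ t) →
           ∀ i → toℕ k ℕ.≤ toℕ i → V i ≤ (if does (V k ≤? t) then t else V k)
    step k t h i k≤i with V k ≤? t | ℕ.m≤n⇒m<n∨m≡n k≤i
    ... | yes Vk≤t | inj₁ k<i = h i k<i
    ... | no  Vk≰t | inj₁ k<i = ≤-trans (h i k<i) (≰⇒≥ Vk≰t)
    ... | yes Vk≤t | inj₂ k≡i = subst (λ i → V i ≤ t) (toℕ-injective k≡i) Vk≤t
    ... | no  Vk≰t | inj₂ k≡i = ≤-reflexive (cong V (sym (toℕ-injective k≡i)))

  supremum-least : ∀ d V {b} → 0# ≤ b → (∀ i → V i ≤ b) → supremum d V ≤ b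
  supremum-least d V {b} 0≤b V≤b = foldDown-invariant (λ _ → _≤ b) d _ step 0≤b
    where
    step : ∀ i t → t ≤ b → (if does (V i ≤? t) then t else V i) ≤ b
    step i t t≤b with V i ≤? t
    ... | yes _ = t≤b
    ... | no  _ = V≤b i

  argmin-minimal : ∀ d c (V : Fin d → Carrier) i → V (argmin d c V) ≤ V i
  argmin-minimal d c₀ V i = foldDown-invariant Smallest d next step
    (λ i d≤i → contradiction d≤i (ℕ.<⇒≱ (toℕ<n i))) i z≤n
    where
    next : Fin d → Fin d → Fin d
    next k c = if does (V k ≤? V c) then k else c
    Smallest : ℕ → Fin d → Set
    Smallest κ c = ∀ (i : Fin d) → κ ℕ.≤ toℕ i → V c ≤ V i
    improve : ∀ k c {i} (d : Dec (V k ≤ V c)) → V c ≤ V i ⊎ k ≡ i → V (if does d then k else c) ≤ V i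
    improve k c (yes Vk≤Vc) (inj₁ Vc≤Vi) = ≤-trans Vk≤Vc Vc≤Vi
    improve k c (yes Vk≤Vc) (inj₂ refl)  = ≤-refl
    improve k c (no  Vk≰Vc) (inj₁ Vc≤Vi) = Vc≤Vi
    improve k c (no  Vk≰Vc) (inj₂ refl)  = ≰⇒≥ Vk≰Vc
    step : ∀ k c → Smallest (suc (toℕ k)) c → Smallest (toℕ k) (next k c)
    step k c h i k≤i = improve k c (V k ≤? V c) (map (h i) toℕ-injective (ℕ.m≤n⇒m<n∨m≡n k≤i))

  loadOf≡machineLoad : ∀ {m} n (σ : Fin n → Fin m) w i → loadOf n σ w i ≡ machineLoad σ w i
  loadOf≡machineLoad n σ w i = trans (unfold n (λ j → does (σ j ≟ i)) w 0#) (+-identityʳ _)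
    where
    add-if : ∀ b x t → (if b then x + t else t) ≡ (if b then x else 0#) + t
    add-if true  x t = refl
    add-if false x t = sym (+-identityˡ t)
    unfold : ∀ n (b : Fin n → Bool) (w : Fin n → Carrier) x →
             foldDown n (λ j t → if b j then w j + t else t) x ≡ sum (λ j → if b j then w j else 0#) + x
    unfold zero    b w x = sym (+-identityˡ x)
    unfold (suc n) b w x = begin
      foldDown n _ (if b (fromℕ n) then w (fromℕ n) + x else x)
        ≡⟨ unfold n (b ∘ inject₁) (w ∘ inject₁) _ ⟩
      sum (λ j → f (inject₁ j)) + (if b (fromℕ n) then w (fromℕ n) + x else x)
        ≡⟨ cong (sum (λ j → f (inject₁ j)) +_) (add-if (b (fromℕ n)) (w (fromℕ n)) x) ⟩
      sum (λ j → f (inject₁ j)) + (f (fromℕ n) + x)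
        ≡⟨ +-assoc _ _ _ ⟨
      sum (λ j → f (inject₁ j)) + f (fromℕ n) + x
        ≡⟨ cong (_+ x) (sum-init-last f) ⟨
      sum f + x ∎
      where
      open ≡-Reasoning
      f : Fin (suc n) → Carrier
      f j = if b j then w j else 0#

  -- The balance invariant under switching, placing and charging

  module _ {m : ℕ} (s cap B : Carrier) (0≤s : 0# ≤ s) (0≤B : 0# ≤ B) where

    -- L and L′ are the loads of the jobs placed so far under the prediction and
    -- under another scenario in which no part of the robust schedule exceeds B,
    -- and r is what the current part still has to place under the latter.
    -- Every part a machine takes jobs from costs it at most B under L′ but is
    -- paid for by s in V, except for the part by which the machine becomes current.
    record Balanced (L L′ : Fin (suc m) → Carrier) (c : Fin (suc m))
                    (V : Fin (suc m) → Carrier) (r : Carrier) : Set where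
      field
        predicted : ∀ i → L i ≤ V i
        capped    : ∀ i → V i ≤ cap + s
        untouched : ∀ i → i ≢ c → V i ≤ cap → s * L′ i ≤ B * V i
        visited   : ∀ i → s * L′ i ≤ B * (V i + s)
        current   : s * (L′ c + r) ≤ B * (V c + s)

    open Balanced

    Balanced-cong : ∀ {L M L′ M′ c V r t} → (∀ i → L i ≡ M i) → (∀ i → L′ i ≡ M′ i) → r ≡ t →
                    Balanced L L′ c V r → Balanced M M′ c V t
    Balanced-cong {c = c} {V} L≡M L′≡M′ refl H = record
      { predicted = λ i → subst (_≤ V i) (L≡M i) (H .predicted i)
      ; capped    = H .capped
      ; untouched = λ i i≢c Vi≤cap → subst (λ l → s * l ≤ _) (L′≡M′ i) (H .untouched i i≢c Vi≤cap)
      ; visited   = λ i → subst (λ l → s * l ≤ _) (L′≡M′ i) (H .visited i)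
      ; current   = subst (λ l → s * (l + _) ≤ _) (L′≡M′ c) (H .current)
      }

    -- At the end of a part the reservation `r` is simply dropped, which spares a proof that nothing
    -- of the part is left.
    Balanced-rest : ∀ {L L′ c V r} → Balanced L L′ c V r → Balanced L L′ c V 0#
    Balanced-rest {L′ = L′} {c} {V} H = record
      { predicted = H .predicted
      ; capped    = H .capped
      ; untouched = H .untouched
      ; visited   = H .visited
      ; current   = subst (λ l → s * l ≤ _) (sym (+-identityʳ (L′ c))) (H .visited c)
      }

    B*-expand : ∀ a b → s * a ≤ B * b → ∀ {x} → x ≤ B → s * (a + x) ≤ B * (b + s)
    B*-expand a b sa≤Bb {x} x≤B = subst₂ _≤_ (sym (distribˡ s a x))
      (trans (cong (B * b +_) (*-comm s B)) (sym (distribˡ B b s)))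
      (+-mono-≤ sa≤Bb (*-monoˡ-≤ 0≤s x≤B))

    -- A minimum is at most the average.
    argmin≤cap : ∀ c V → sum V ≤ sum {suc m} (λ _ → cap) → V (argmin (suc m) c V) ≤ cap
    argmin≤cap c V ΣV≤ = sum-const-cancel-≤ m (≤-trans (sum-mono-≤ (argmin-minimal (suc m) c V)) ΣV≤)

    -- The old machine is left only above `cap`, so any machine with at most `cap` differs from it
    -- and is covered by `untouched`. In particular the newly chosen one still satisfies the bound
    -- without the extra `s`.
    pick-Balanced : ∀ {L L′ c V r} → r ≤ B → sum V ≤ sum {suc m} (λ _ → cap) → Balanced L L′ c V r →
                    let i = pick (suc m) cap (c , V) in V i ≤ cap × Balanced L L′ i V r
    pick-Balanced {L} {L′} {c} {V} {r} r≤B ΣV≤ H with V c ≤? cap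
    ... | yes Vc≤cap = Vc≤cap , H
    ... | no  Vc≰cap = Vi≤cap , record
      { predicted = H .predicted
      ; capped    = H .capped
      ; untouched = λ j _ Vj≤cap → H .untouched j (≢c Vj≤cap) Vj≤cap
      ; visited   = H .visited
      -- The rest of the part in progress reaches the new machine without a charge; this uses up the
      -- extra `s` allowed there.
      ; current   = B*-expand (L′ i) (V i) (H .untouched i (≢c Vi≤cap) Vi≤cap) r≤B
      }
      where
      i = argmin (suc m) c V
      Vi≤cap = argmin≤cap c V ΣV≤
      ≢c : ∀ {j} → V j ≤ cap → j ≢ c
      ≢c Vj≤cap refl = Vc≰cap Vj≤cap

    module _ {L L′ M M′ : Fin (suc m) → Carrier} {i : Fin (suc m)} {V : Fin (suc m) → Carrier} {r t x : Carrier}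
             (0≤x : 0# ≤ x) (x≤s : x ≤ s) (Vi≤cap : V i ≤ cap)
             (Mi≤ : M i ≤ L i + x)
             (M≡ : ∀ j → j ≢ i → M j ≡ L j) (M′≡ : ∀ j → j ≢ i → M′ j ≡ L′ j)
             (M′i≤ : s * M′ i ≤ B * (V i + x + s)) (M′+t≤ : s * (M′ i + t) ≤ B * (V i + x + s)) where

      -- Used twice: for a job, with `x = p j` and its load added on machine `i`, and for a charge,
      -- with `x = s` and unchanged loads. This is why `Mi≤` is only an inequality.
      raise-Balanced : Balanced L L′ i V r → Balanced M M′ i (update i (V i + x) V) t
      raise-Balanced H = record
        { predicted = λ j → predicted′ j (j ≟ i)
        ; capped    = λ j → capped′ j (j ≟ i)
        ; untouched = λ j j≢i Vj≤cap → subst₂ (λ l v → s * l ≤ B * v) (sym (M′≡ j j≢i))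
            (sym (update-minimal i {f = V} j j≢i))
            (H .untouched j j≢i (subst (_≤ cap) (update-minimal i {f = V} j j≢i) Vj≤cap))
        ; visited   = λ j → visited′ j (j ≟ i)
        ; current   = subst (λ v → _ ≤ B * (v + s)) (sym V′i≡) M′+t≤
        }
        where
        V′ = update i (V i + x) V
        V′i≡ : V′ i ≡ V i + x
        V′i≡ = update-updates i {f = V}
        predicted′ : ∀ j → Dec (j ≡ i) → M j ≤ V′ j
        predicted′ j (yes refl) = ≤-trans Mi≤ (subst (L i + x ≤_) (sym V′i≡) (+-monoˡ-≤ _ _ x (H .predicted i)))
        predicted′ j (no j≢i)   = subst₂ _≤_ (sym (M≡ j j≢i)) (sym (update-minimal i {f = V} j j≢i))
          (H .predicted j)
        capped′ : ∀ j → Dec (j ≡ i) → V′ j ≤ cap + s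
        capped′ j (yes refl) = subst (_≤ cap + s) (sym V′i≡) (+-mono-≤ Vi≤cap x≤s)
        capped′ j (no j≢i)   = subst (_≤ cap + s) (sym (update-minimal i {f = V} j j≢i)) (H .capped j)
        visited′ : ∀ j → Dec (j ≡ i) → s * M′ j ≤ B * (V′ j + s)
        visited′ j (yes refl) = subst (λ v → _ ≤ B * (v + s)) (sym V′i≡) M′i≤
        visited′ j (no j≢i)   = subst₂ (λ l v → s * l ≤ B * (v + s)) (sym (M′≡ j j≢i))
          (sym (update-minimal i {f = V} j j≢i)) (H .visited j)

    sum-raise : ∀ i {x} V → sum (update i (V i + x) V) ≡ sum {suc m} V + x
    sum-raise i {x} V = trans (sym (+-identityʳ _)) (sum-change {f = update i (V i + x) V} {g = V} i
      (trans (+-identityʳ _) (update-updates i {f = V})) (λ j j≢i → update-minimal i {f = V} j j≢i))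

  -- Loads when a single job changes

  module _ {m n : ℕ} (σ : Fin n → Fin m) {v w : Fin n → Carrier} (j : Fin n)
           (v≡w : ∀ l → l ≢ j → v l ≡ w l) where

    -- Job `j` has weight 0 under `w`, so its previous machine does not matter. For a pending job
    -- this is the machine inherited from `N`.
    machineLoad-assign : ∀ i → w j ≡ 0# → ∀ i′ →
      machineLoad (update j i σ) v i′ ≡ machineLoad σ w i′ + (if does (i ≟ i′) then v j else 0#)
    machineLoad-assign i wj≡0 i′ = trans (sym (+-identityʳ _)) (sum-change
      {f = λ l → if does (update j i σ l ≟ i′) then v l else 0#}
      {g = λ l → if does (σ l ≟ i′) then w l else 0#} j
      (begin
        (if does (update j i σ j ≟ i′) then v j else 0#) + 0#
          ≡⟨ +-identityʳ _ ⟩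
        (if does (update j i σ j ≟ i′) then v j else 0#)
          ≡⟨ cong (λ k → if does (k ≟ i′) then v j else 0#) (update-updates j {f = σ}) ⟩
        (if does (i ≟ i′) then v j else 0#)
          ≡⟨ +-identityˡ _ ⟨
        0# + (if does (i ≟ i′) then v j else 0#)
          ≡⟨ cong (_+ (if does (i ≟ i′) then v j else 0#)) (if-same (does (σ j ≟ i′))) ⟨
        (if does (σ j ≟ i′) then w j else 0#) + (if does (i ≟ i′) then v j else 0#) ∎)
      (λ l l≢j → cong₂ (λ k x → if does (k ≟ i′) then x else 0#) (update-minimal j {f = σ} l l≢j) (v≡w l l≢j)))
      where
      open ≡-Reasoning
      if-same : ∀ b → (if b then w j else 0#) ≡ 0#
      if-same true  = wj≡0
      if-same false = refl

    machineLoad-remove : ∀ {x} → v j + x ≡ w j → machineLoad σ v (σ j) + x ≡ machineLoad σ w (σ j)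
    machineLoad-remove {x} vj+x≡wj = trans (sum-change
      {f = λ l → if does (σ l ≟ σ j) then v l else 0#} {g = λ l → if does (σ l ≟ σ j) then w l else 0#} j
      (begin
        (if does (σ j ≟ σ j) then v j else 0#) + x  ≡⟨ cong (λ b → (if b then v j else 0#) + x) σj≟σj ⟩
        v j + x                                     ≡⟨ vj+x≡wj ⟩
        w j                                         ≡⟨ +-identityʳ _ ⟨
        w j + 0#                                    ≡⟨ cong (λ b → (if b then w j else 0#) + 0#) σj≟σj ⟨
        (if does (σ j ≟ σ j) then w j else 0#) + 0# ∎)
      (λ l l≢j → cong (if does (σ l ≟ σ j) then_else 0#) (v≡w l l≢j)))
      (+-identityʳ _)
      where
      open ≡-Reasoning
      σj≟σj = dec-true (σ j ≟ σ j) refl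

  -- The order of service and the invariant of the whole run

  module _ {m n : ℕ} (s cap B : Carrier) (0≤s : 0# ≤ s) (0≤B : 0# ≤ B)
           (R : Fin n → Fin (suc m)) (p q : Fin n → Carrier)
           (0≤p : ∀ j → 0# ≤ p j) (0≤q : ∀ j → 0# ≤ q j)
           (part≤B : ∀ k → machineLoad R q k ≤ B) where

    private
      M = suc m
      Bal = Balanced {m} s cap B 0≤s 0≤B

    -- This is `toℕ j + toℕ (R j) * n`, the position of the pair of part and job in the two nested
    -- loops, so that one counter describes the progress of both.
    key : Fin n → ℕ
    key j = toℕ (combine (R j) j)

    toℕ-combine-comm : ∀ (k : Fin M) (j : Fin n) → toℕ (combine k j) ≡ toℕ j ℕ.+ toℕ k ℕ.* n
    toℕ-combine-comm k j = trans (toℕ-combine k j) (trans (ℕ.+-comm (n ℕ.* toℕ k) (toℕ j))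
      (cong (toℕ j ℕ.+_) (ℕ.*-comm n (toℕ k))))

    key-injective : ∀ {i j} → key i ≡ key j → i ≡ j
    key-injective {i} {j} e = proj₂ (combine-injective (R i) i (R j) j (toℕ-injective e))

    decode-key : ∀ k j l → key l ≡ toℕ j ℕ.+ toℕ k ℕ.* n → R l ≡ k × l ≡ j
    decode-key k j l kl≡ =
      combine-injective (R l) l k j (toℕ-injective (trans kl≡ (sym (toℕ-combine-comm k j))))

    -- Jobs are placed in order of decreasing key; β is the first key already served.
    pending : ℕ → Fin n → Bool
    pending β j = does (p j ≤? s) ∧ does (key j ℕ.<? β)

    -- Long jobs are never pending and hence count as placed from the start.
    placed unplaced : ℕ → (Fin n → Carrier) → Fin n → Carrier
    placed   β w j = if pending β j then 0# else w j
    unplaced β w j = if pending β j then w j else 0#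

    pending-suc : ∀ {j β} → p j ≤ s → key j ≡ β → pending (suc β) j ≡ true
    pending-suc {j} {β} pj≤s kj≡β =
      cong₂ _∧_ (dec-true (p j ≤? s) pj≤s) (dec-true (key j ℕ.<? suc β) (ℕ.≤-reflexive (cong suc kj≡β)))

    pending-same : ∀ {j β} → p j ≤ s → key j ≡ β → pending β j ≡ false
    pending-same {j} {β} pj≤s kj≡β =
      cong₂ _∧_ (dec-true (p j ≤? s) pj≤s) (dec-false (key j ℕ.<? β) (ℕ.<-irrefl kj≡β))

    pending-other : ∀ {j} β → (p j ≤ s → key j ≢ β) → pending β j ≡ pending (suc β) j
    pending-other {j} β ≢β with p j ≤? s
    ... | no  _    = refl
    ... | yes pj≤s with ℕ.<-cmp (key j) β
    ...   | tri< k<β _ _ = trans (dec-true (key j ℕ.<? β) k<β)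
            (sym (dec-true (key j ℕ.<? suc β) (ℕ.m<n⇒m<1+n k<β)))
    ...   | tri≈ _ k≡β _ = contradiction k≡β (≢β pj≤s)
    ...   | tri> _ _ β<k = trans (dec-false (key j ℕ.<? β) (ℕ.<⇒≯ β<k))
            (sym (dec-false (key j ℕ.<? suc β) (ℕ.≤⇒≯ β<k)))

    -- The left side of the second component is conserved: placing a job moves `p j` from the
    -- unplaced total into `V`, and starting a part moves one of the `κ` outstanding charges there.
    -- Hence the amounts average at most `cap` throughout, as every choice of a least loaded machine
    -- requires.
    Invariant : ℕ → ℕ → Carrier → State M n → Set
    Invariant β κ r (σ , c , V) =
      Bal (machineLoad σ (placed β p)) (machineLoad σ (placed β q)) c V r ×
      sum V + sum (unplaced β p) + sum {κ} (λ _ → s) ≤ sum {M} (λ _ → cap)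

    remaining : ℕ → Fin M → Carrier
    remaining β = machineLoad R (unplaced β q)

    0≤unplaced : ∀ β {w} → (∀ j → 0# ≤ w j) → ∀ j → 0# ≤ unplaced β w j
    0≤unplaced β 0≤w j = if-nonNegative (pending β j) (0≤w j)

    0≤remaining : ∀ β k → 0# ≤ remaining β k
    0≤remaining β = machineLoad-nonNegative R (0≤unplaced β 0≤q)

    remaining≤B : ∀ β k → remaining β k ≤ B
    remaining≤B β k = ≤-trans (machineLoad-mono-≤ R (λ j → if-≤ (pending β j) (0≤q j)) k) (part≤B k)

    within-budget : ∀ {β κ} {V : Fin M → Carrier} →
                    sum V + sum (unplaced β p) + sum {κ} (λ _ → s) ≤ sum {M} (λ _ → cap) →
                    sum V ≤ sum {M} (λ _ → cap)
    within-budget {β} {κ} {V} h = ≤-trans (≤-trans (x≤x+y (sum V) (sum-nonNegative (0≤unplaced β 0≤p)))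
      (x≤x+y _ (sum-nonNegative {κ} (λ _ → 0≤s)))) h

    open Balanced

    assign-Invariant : ∀ {β κ} j {S} → p j ≤ s → key j ≡ β →
      Invariant (suc β) κ (remaining (suc β) (R j)) S →
      Invariant β κ (remaining β (R j)) (assign M cap (p j) j S)
    assign-Invariant {β} {κ} j {σ , c , V} pj≤s kj≡β (H , budget) =
      raise-Balanced {m} s cap B 0≤s 0≤B {before p} {before q} {after p} {after q} {i} {V}
        (0≤p j) pj≤s (proj₁ picked) (≤-reflexive (load-i p)) (load-≢ p) (load-≢ q)
        (≤-trans (*-monoˡ-≤ 0≤s (x≤x+y _ (0≤remaining β (R j)))) cur≤) cur≤ (proj₂ picked) ,
      subst (_≤ sum {M} (λ _ → cap)) budget≡ budget
      where
      i : Fin M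
      i = pick M cap (c , V)
      before after : (Fin n → Carrier) → Fin M → Carrier
      before w = machineLoad σ (placed (suc β) w)
      after w  = machineLoad (update j i σ) (placed β w)
      picked : V i ≤ cap × Bal (before p) (before q) i V (remaining (suc β) (R j))
      picked = pick-Balanced {m} s cap B 0≤s 0≤B {before p} {before q} {c} {V}
        (remaining≤B (suc β) (R j)) (within-budget {suc β} {κ} {V} budget) H
      other : ∀ l → l ≢ j → pending β l ≡ pending (suc β) l
      other l l≢j = pending-other β (λ _ kl≡β → l≢j (key-injective (trans kl≡β (sym kj≡β))))
      load : ∀ w i′ → after w i′ ≡
             before w i′ + (if does (i ≟ i′) then w j else 0#)
      load w i′ = trans
        (machineLoad-assign σ {placed β w} {placed (suc β) w} j
          (λ l l≢j → cong (if_then 0# else w l) (other l l≢j)) i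
          (cong (if_then 0# else w j) (pending-suc pj≤s kj≡β)) i′)
        (cong (λ x → before w i′ + (if does (i ≟ i′) then x else 0#))
          (cong (if_then 0# else w j) (pending-same pj≤s kj≡β)))
      load-i : ∀ w → after w i ≡ before w i + w j
      load-i w = trans (load w i) (cong (λ b → before w i + (if b then w j else 0#))
        (dec-true (i ≟ i) refl))
      load-≢ : ∀ w i′ → i′ ≢ i → after w i′ ≡ before w i′
      load-≢ w i′ i′≢i = trans (load w i′)
        (trans (cong (λ b → before w i′ + (if b then w j else 0#))
                 (dec-false (i ≟ i′) (i′≢i ∘ sym)))
               (+-identityʳ _))
      unplaced-j : ∀ w → unplaced β w j + w j ≡ unplaced (suc β) w j
      unplaced-j w = trans (cong (λ b → (if b then w j else 0#) + w j) (pending-same pj≤s kj≡β))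
        (trans (+-identityˡ (w j)) (sym (cong (if_then w j else 0#) (pending-suc pj≤s kj≡β))))
      unplaced-≢ : ∀ w l → l ≢ j → unplaced β w l ≡ unplaced (suc β) w l
      unplaced-≢ w l l≢j = cong (if_then w l else 0#) (other l l≢j)
      L′ = before q i
      -- The job passes from the reserved rest of its part to the load, so the sum bounded by
      -- `current` stays the same.
      cur≡ : after q i + remaining β (R j) ≡ L′ + remaining (suc β) (R j)
      cur≡ = begin
        after q i + remaining β (R j) ≡⟨ cong (_+ remaining β (R j)) (load-i q) ⟩
        L′ + q j + remaining β (R j)   ≡⟨ solve 3 (λ a b c → a :+ b :+ c := a :+ (c :+ b)) refl L′ (q j) _ ⟩
        L′ + (remaining β (R j) + q j) ≡⟨ cong (L′ +_) (machineLoad-remove R {unplaced β q} {unplaced (suc β) q} j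
                                             (unplaced-≢ q) (unplaced-j q)) ⟩
        L′ + remaining (suc β) (R j)   ∎
        where open ≡-Reasoning
      cur≤ : s * (after q i + remaining β (R j)) ≤ B * (V i + p j + s)
      cur≤ = subst (λ l → s * l ≤ B * (V i + p j + s)) (sym cur≡)
        (≤-trans (proj₂ picked .current) (*-monoˡ-≤ 0≤B (+-monoˡ-≤ _ _ s (x≤x+y (V i) (0≤p j)))))
      budget≡ : sum V + sum (unplaced (suc β) p) + sum {κ} (λ _ → s) ≡
                sum (update i (V i + p j) V) + sum (unplaced β p) + sum {κ} (λ _ → s)
      budget≡ = cong (_+ sum {κ} (λ _ → s)) (begin
        sum V + sum (unplaced (suc β) p)
          ≡⟨ cong (sum V +_) (trans (sym (+-identityʳ _))
               (sym (sum-change {f = unplaced β p} {unplaced (suc β) p} j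
               (trans (unplaced-j p) (sym (+-identityʳ _))) (unplaced-≢ p)))) ⟩
        sum V + (sum (unplaced β p) + p j)
          ≡⟨ solve 3 (λ a b c → a :+ (b :+ c) := a :+ c :+ b) refl (sum V) _ (p j) ⟩
        sum V + p j + sum (unplaced β p)
          ≡⟨ cong (_+ sum (unplaced β p)) (sum-raise {m} s cap B 0≤s 0≤B i V) ⟨
        sum (update i (V i + p j) V) + sum (unplaced β p) ∎)
        where open ≡-Reasoning

    -- Adding `s` to the amount raises the right side of the bound by `B * s`, enough to reserve the
    -- whole rest of the new part under `q`.
    charge-Invariant : ∀ {β κ} k {σ cV} → Invariant β (suc κ) 0# (σ , cV) →
                       Invariant β κ (remaining β k) (σ , put M cap s cV)
    charge-Invariant {β} {κ} k {σ} {c , V} (H , budget) =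
      raise-Balanced {m} s cap B 0≤s 0≤B {L p} {L q} {L p} {L q} {i} {V}
        0≤s ≤-refl (proj₁ picked) (x≤x+y _ 0≤s) (λ _ _ → refl) (λ _ _ → refl)
        (≤-trans visited-i (*-monoˡ-≤ 0≤B (+-monoˡ-≤ _ _ s (x≤x+y (V i) 0≤s))))
        (B*-expand {m} s cap B 0≤s 0≤B (L q i) (V i + s) visited-i (remaining≤B β k))
        (proj₂ picked) ,
      subst (_≤ sum {M} (λ _ → cap)) budget≡ budget
      where
      i : Fin M
      i = pick M cap (c , V)
      L : (Fin n → Carrier) → Fin M → Carrier
      L w = machineLoad σ (placed β w)
      picked : V i ≤ cap × Bal (L p) (L q) i V 0#
      picked = pick-Balanced {m} s cap B 0≤s 0≤B {L p} {L q} {c} {V}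
        0≤B (within-budget {β} {suc κ} {V} budget) H
      visited-i : s * L q i ≤ B * (V i + s)
      visited-i = proj₂ picked .visited i
      budget≡ : sum V + sum (unplaced β p) + sum {suc κ} (λ _ → s) ≡
                sum (update i (V i + s) V) + sum (unplaced β p) + sum {κ} (λ _ → s)
      budget≡ = trans
        (solve 4 (λ a b c d → a :+ b :+ (c :+ d) := a :+ c :+ b :+ d) refl
          (sum V) (sum (unplaced β p)) s (sum {κ} (λ _ → s)))
        (cong (λ a → a + sum (unplaced β p) + sum {κ} (λ _ → s)) (sym (sum-raise {m} s cap B 0≤s 0≤B i V)))

    skip-Invariant : ∀ {β κ} k {S} → (∀ j → p j ≤ s → key j ≢ β) →
                     Invariant (suc β) κ (remaining (suc β) k) S → Invariant β κ (remaining β k) S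
    skip-Invariant {β} {κ} k {σ , c , V} ≢β (H , budget) =
      Balanced-cong {m} s cap B 0≤s 0≤B
        {machineLoad σ (placed (suc β) p)} {machineLoad σ (placed β p)}
        {machineLoad σ (placed (suc β) q)} {machineLoad σ (placed β q)} {c} {V}
        (machineLoad-cong σ (placed-same p)) (machineLoad-cong σ (placed-same q))
        (machineLoad-cong R (unplaced-same q) k) H ,
      subst (λ u → sum V + u + sum {κ} (λ _ → s) ≤ sum {M} (λ _ → cap)) (sum-cong-≗ (unplaced-same p)) budget
      where
      same : ∀ j → pending (suc β) j ≡ pending β j
      same j = sym (pending-other β (≢β j))
      placed-same : ∀ w j → placed (suc β) w j ≡ placed β w j
      placed-same w j = cong (if_then 0# else w j) (same j)
      unplaced-same : ∀ w j → unplaced (suc β) w j ≡ unplaced β w j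
      unplaced-same w j = cong (if_then w j else 0#) (same j)

    -- Only job `j` can have key `β`, and only if it belongs to part `k`. In every other case, and
    -- for a long job, lowering the counter changes no pending status.
    place-Invariant : ∀ {κ} k j S → let β = toℕ j ℕ.+ toℕ k ℕ.* n in
      Invariant (suc β) κ (remaining (suc β) k) S →
      Invariant β κ (remaining β k) (place M s cap p R k j S)
    place-Invariant {κ} k j S H with p j ≤? s | R j ≟ k
    ... | yes pj≤s | yes refl = assign-Invariant {κ = κ} j {S} pj≤s (toℕ-combine-comm (R j) j) H
    ... | yes pj≤s | no Rj≢k  = skip-Invariant {κ = κ} k {S} (λ l _ kl≡ → Rj≢k (decode l kl≡)) H
      where
      decode : ∀ l → key l ≡ toℕ j ℕ.+ toℕ k ℕ.* n → R j ≡ k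
      decode l kl≡ with Rl≡k , refl ← decode-key k j l kl≡ = Rl≡k
    ... | no pj≰s  | _        = skip-Invariant {κ = κ} k {S} (λ l pl≤s kl≡ → pj≰s (decode l pl≤s kl≡)) H
      where
      decode : ∀ l → p l ≤ s → key l ≡ toℕ j ℕ.+ toℕ k ℕ.* n → p j ≤ s
      decode l pl≤s kl≡ with _ , refl ← decode-key k j l kl≡ = pl≤s

    processPart-Invariant : ∀ k S → Invariant (suc (toℕ k) ℕ.* n) (suc (toℕ k)) 0# S →
                            Invariant (toℕ k ℕ.* n) (toℕ k) 0# (processPart M s cap p R k S)
    processPart-Invariant k (σ , cV) H = rest
      {toℕ k ℕ.* n} {toℕ k} (processPart M s cap p R k (σ , cV)) (foldDown-invariant
      (λ ι → Invariant (ι ℕ.+ toℕ k ℕ.* n) (toℕ k) (remaining (ι ℕ.+ toℕ k ℕ.* n) k))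
      n (place M s cap p R k) {σ , put M cap s cV} (place-Invariant {toℕ k} k)
      -- By definition `n + toℕ k * n` is `suc (toℕ k) * n`, so the job loop starts where the
      -- previous part stopped.
      (charge-Invariant {n ℕ.+ toℕ k ℕ.* n} {toℕ k} k {σ} {cV} H))
      where
      rest : ∀ {β κ r} S → Invariant β κ r S → Invariant β κ 0# S
      rest {β} (σ , c , V) (H , budget) = Balanced-rest {m} s cap B 0≤s 0≤B
        {machineLoad σ (placed β p)} {machineLoad σ (placed β q)} {c} {V} H , budget

    module _ (N : Fin n → Fin M) (N≤cap : ∀ i → machineLoad N p i ≤ cap)
             (capacity : sum p + sum {M} (λ _ → s) ≤ sum {M} (λ _ → cap)) where

      private
        V₀ : Fin M → Carrier
        V₀ = loadOf n N (bigOnly s p)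

        V₀≡ : ∀ i → V₀ i ≡ machineLoad N (bigOnly s p) i
        V₀≡ = loadOf≡machineLoad n N (bigOnly s p)

      pending-all : ∀ j → pending (M ℕ.* n) j ≡ does (p j ≤? s)
      pending-all j with p j ≤? s
      ... | no _  = refl
      ... | yes _ = dec-true (key j ℕ.<? M ℕ.* n) (toℕ<n (combine (R j) j))

      placed-all : ∀ w j → placed (M ℕ.* n) w j ≡ (if does (p j ≤? s) then 0# else w j)
      placed-all w j = cong (if_then 0# else w j) (pending-all j)

      bigOnly≤ : ∀ j → bigOnly s p j ≤ p j
      bigOnly≤ j with p j ≤? s
      ... | yes _ = 0≤p j
      ... | no  _ = ≤-refl

      -- A long job has `s ≤ p j`, and `q j ≤ B` because it lies in some part of `R`; hence
      -- `s * q j ≤ s * B ≤ B * p j`.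
      big-cost : ∀ j → s * placed (M ℕ.* n) q j ≤ B * bigOnly s p j
      big-cost j = subst (λ x → s * x ≤ _) (sym (placed-all q j)) (cost (p j ≤? s))
        where
        cost : (d : Dec (p j ≤ s)) → s * (if does d then 0# else q j) ≤ B * (if does d then 0# else p j)
        cost (yes _)   = ≤-reflexive (trans (zeroʳ s) (sym (zeroʳ B)))
        cost (no pj≰s) = ≤-trans (*-monoˡ-≤ 0≤s (≤-trans (weight≤machineLoad R {q} 0≤q j) (part≤B (R j))))
          (subst (_≤ B * p j) (*-comm B s) (*-monoˡ-≤ 0≤B (≰⇒≥ pj≰s)))

      initial-Invariant : Invariant (M ℕ.* n) M 0# (N , zero , V₀)
      initial-Invariant = record
        { predicted = λ i → ≤-reflexive (trans (machineLoad-cong N (placed-all p) i) (sym (V₀≡ i)))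
        ; capped    = λ i → subst (_≤ cap + s) (sym (V₀≡ i)) (≤-trans (machineLoad-mono-≤ N bigOnly≤ i)
                        (≤-trans (N≤cap i) (x≤x+y cap 0≤s)))
        -- Long jobs are fully paid for by their own predicted sizes, so every machine starts with
        -- its extra `s` unspent.
        ; untouched = λ i _ _ → paid i
        ; visited   = λ i → ≤-trans (paid i) (*-monoˡ-≤ 0≤B (x≤x+y (V₀ i) 0≤s))
        ; current   = subst (λ l → s * l ≤ B * (V₀ zero + s)) (sym (+-identityʳ (L′ zero)))
                        (≤-trans (paid zero) (*-monoˡ-≤ 0≤B (x≤x+y (V₀ zero) 0≤s)))
        } ,
        subst (λ a → a + sum {M} (λ _ → s) ≤ sum {M} (λ _ → cap)) (sym total) capacity
        where
        L′ : Fin M → Carrier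
        L′ = machineLoad N (placed (M ℕ.* n) q)
        paid : ∀ i → s * L′ i ≤ B * V₀ i
        paid i = subst₂ _≤_ (sym (*-machineLoad N s (placed (M ℕ.* n) q) i))
          (trans (sym (*-machineLoad N B (bigOnly s p) i)) (cong (B *_) (sym (V₀≡ i))))
          (machineLoad-mono-≤ N big-cost i)
        total : sum V₀ + sum (unplaced (M ℕ.* n) p) ≡ sum p
        total = begin
          sum V₀ + sum (unplaced (M ℕ.* n) p)
            ≡⟨ cong (_+ sum (unplaced (M ℕ.* n) p)) (trans (sum-cong-≗ V₀≡) (sum-machineLoad N (bigOnly s p))) ⟩
          sum (bigOnly s p) + sum (unplaced (M ℕ.* n) p)
            ≡⟨ ∑-distrib-+ (bigOnly s p) (unplaced (M ℕ.* n) p) ⟨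
          sum (λ j → bigOnly s p j + unplaced (M ℕ.* n) p j)
            ≡⟨ sum-cong-≗ (λ j → trans (cong (λ b → bigOnly s p j + (if b then p j else 0#)) (pending-all j))
                 (if-+ (does (p j ≤? s)) (p j))) ⟩
          sum p ∎
          where
          open ≡-Reasoning
          if-+ : ∀ b x → (if b then 0# else x) + (if b then x else 0#) ≡ x
          if-+ true  x = +-identityˡ x
          if-+ false x = +-identityʳ x

      final-bounds : let σ = proj₁ (foldDown M (processPart M s cap p R) (N , zero , V₀)) in ∀ i →
                     machineLoad σ p i ≤ cap + s × s * machineLoad σ q i ≤ B * (cap + s + s)
      final-bounds i = extract (foldDown M (processPart M s cap p R) start)
        (foldDown-invariant (λ κ → Invariant (κ ℕ.* n) κ 0#) M
          (processPart M s cap p R) {start} processPart-Invariant initial-Invariant)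
        where
        start : State M n
        start = N , zero , V₀
        pending-none : ∀ j → pending 0 j ≡ false
        pending-none j with p j ≤? s
        ... | yes _ = refl
        ... | no  _ = refl
        placed-none : ∀ w j → placed 0 w j ≡ w j
        placed-none w j = cong (if_then 0# else w j) (pending-none j)
        extract : ∀ S → Invariant 0 0 0# S →
                  machineLoad (proj₁ S) p i ≤ cap + s × s * machineLoad (proj₁ S) q i ≤ B * (cap + s + s)
        extract (σ , c , V) (H , _) =
          subst (_≤ cap + s) (machineLoad-cong σ (placed-none p) i) (≤-trans (H .predicted i) (H .capped i)) ,
          subst (λ l → s * l ≤ B * (cap + s + s)) (machineLoad-cong σ (placed-none q) i)
            (≤-trans (H .visited i) (*-monoˡ-≤ 0≤B (+-monoˡ-≤ _ _ s (H .capped i))))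

-- Consistency, robustness and running time

module Combination (ℝ : CompleteOrderedField) where
  open CompleteOrderedField ℝ
  open FieldProperties ℝ
  open Computation ℝ
  open Compilation ℝ
  open Algorithm ℝ
  open Balancing ℝ

  module _ {λ′ : Carrier} (0<λ′ : 0# < λ′) where

    private
      λ⁻¹ : Carrier
      λ⁻¹ = λ′ ⁻¹

      0≤λ′ : 0# ≤ λ′
      0≤λ′ = proj₁ 0<λ′

      λ′*λ⁻¹≡1 : λ′ * λ⁻¹ ≡ 1#
      λ′*λ⁻¹≡1 = *-inverseʳ λ′ (proj₂ 0<λ′ ∘ sym)

      cancel : ∀ T → λ′ * (T * λ⁻¹) ≡ T
      cancel T = trans (solve 3 (λ l t i → l :* (t :* i) := t :* (l :* i)) refl λ′ T λ⁻¹)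
        (trans (cong (T *_) λ′*λ⁻¹≡1) (*-identityʳ T))

    threshold-positive : ∀ {T} → 0# ≤ T → 0# < threshold λ⁻¹ T
    threshold-positive {T} 0≤T with T ≤? 0#
    ... | yes _  = 0≤1 , 0≢1
    ... | no T≰0 = *-nonNegative T λ⁻¹ 0≤T (⁻¹-nonNegative 0<λ′) ,
      λ 0≡ → T≰0 (≤-reflexive (trans (sym (cancel T)) (trans (cong (λ′ *_) (sym 0≡)) (zeroʳ λ′))))

    -- Equality holds for positive `T`; the inequality, which also covers the default threshold 1,
    -- is the direction needed to turn `T` into multiples of `s`.
    ≤λ′*threshold : ∀ T → T ≤ λ′ * threshold λ⁻¹ T
    ≤λ′*threshold T with T ≤? 0#
    ... | yes T≤0 = ≤-trans T≤0 (*-nonNegative λ′ 1# 0≤λ′ 0≤1)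
    ... | no _    = ≤-reflexive (sym (cancel T))

    module _ {m n : ℕ} {p q : Fin n → Carrier} (0≤p : ∀ j → 0# ≤ p j) (0≤q : ∀ j → 0# ≤ q j)
             (N R : Fin n → Fin (suc m)) {B : Carrier} (part≤B : ∀ k → machineLoad R q k ≤ B) where

      private
        M = suc m

        T s : Carrier
        T = supremum M (loadOf n N p)
        s = threshold λ⁻¹ T

        0≤T : 0# ≤ T
        0≤T = supremum-nonNegative M (loadOf n N p)

        0<s : 0# < s
        0<s = threshold-positive 0≤T

        0≤B : 0# ≤ B
        0≤B = ≤-trans (machineLoad-nonNegative R {q} 0≤q zero) (part≤B zero)

        load≤T : ∀ i → machineLoad N p i ≤ T
        load≤T i = subst (_≤ T) (loadOf≡machineLoad n N p i) (supremum-upper M (loadOf n N p) i)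

        capacity : sum p + sum {M} (λ _ → s) ≤ sum {M} (λ _ → T + s)
        capacity = subst₂ _≤_ (cong (_+ sum {M} (λ _ → s)) (sum-machineLoad N p))
          (sym (∑-distrib-+ {M} (λ _ → T) (λ _ → s)))
          (+-monoˡ-≤ _ _ (sum {M} (λ _ → s)) (sum-mono-≤ {M} load≤T))

        σ : Fin n → Fin M
        σ = merge m λ⁻¹ p N R

        bounds : ∀ i → machineLoad σ p i ≤ T + s + s × s * machineLoad σ q i ≤ B * (T + s + s + s)
        bounds = final-bounds {m} {n} s (T + s) B (proj₁ 0<s) 0≤B R p q 0≤p 0≤q part≤B N
          (λ i → ≤-trans (load≤T i) (x≤x+y T (proj₁ 0<s))) capacity

      merge-robust : ∀ i → machineLoad σ q i ≤ (2# * λ′ + 4#) * B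
      merge-robust i = *-cancelˡ-≤ 0<s (≤-trans (proj₂ (bounds i))
        (≤-trans (*-monoˡ-≤ 0≤B (≤-trans
            (+-monoˡ-≤ _ _ s (+-monoˡ-≤ _ _ s (+-monoˡ-≤ _ _ s (≤λ′*threshold T))))
            (x≤x+y (λ′ * s + s + s + s) (+-nonNegative (*-nonNegative λ′ s 0≤λ′ (proj₁ 0<s)) (proj₁ 0<s)))))
          (≤-reflexive regroup)))
        where
        regroup : B * (λ′ * s + s + s + s + (λ′ * s + s)) ≡ s * ((2# * λ′ + 4#) * B)
        -- The solver variable `u` stands for `1#`, so that `2#` and `4#` become sums of `u`.
        -- Writing `s` as `1# * s` gives each term on the left the factor `u` that it has on the
        -- right.
        regroup = trans (cong (λ a → B * (λ′ * a + a + a + a + (λ′ * a + a))) (sym (*-identityˡ s)))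
          (solve 4 (λ u l t b →
              b :* (l :* (u :* t) :+ u :* t :+ u :* t :+ u :* t :+ (l :* (u :* t) :+ u :* t)) :=
              t :* (((u :+ u) :* l :+ (u :+ u :+ (u :+ u))) :* b)) refl 1# λ′ s B)

      merge-consistent : ∀ i → machineLoad σ p i ≤ T * (1# + 2# * λ⁻¹)
      merge-consistent i = go (T ≤? 0#) (proj₁ (bounds i))
        where
        go : (d : Dec (T ≤ 0#)) → (let s = if does d then 1# else T * λ⁻¹ in machineLoad σ p i ≤ T + s + s) →
             machineLoad σ p i ≤ T * (1# + 2# * λ⁻¹)
        -- Here `s` is 1 and the general bound `T + s + s` is too weak; instead, every job has
        -- predicted size 0.
        go (yes T≤0) _ = ≤-trans (≤-trans (machineLoad-mono-≤ σ p≤0 i) (≤-reflexive zero-load))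
          (*-nonNegative T _ 0≤T (+-nonNegative 0≤1
            (*-nonNegative 2# λ⁻¹ (+-nonNegative 0≤1 0≤1) (⁻¹-nonNegative 0<λ′))))
          where
          p≤0 : ∀ j → p j ≤ 0#
          p≤0 j = ≤-trans (weight≤machineLoad N {p} 0≤p j) (≤-trans (load≤T (N j)) T≤0)
          if-0 : ∀ b → (if b then 0# else 0#) ≡ 0#
          if-0 true  = refl
          if-0 false = refl
          zero-load : machineLoad σ (λ _ → 0#) i ≡ 0#
          zero-load = trans (sum-cong-≗ (λ j → if-0 (does (σ j ≟ i)))) (sum-replicate-zero n)
        go (no _) h = ≤-trans h (≤-reflexive (trans
          (cong (λ t → t + T * λ⁻¹ + T * λ⁻¹) (sym (*-identityʳ T)))
          (trans (cong (λ a → T * 1# + a + a) (cong (T *_) (sym (*-identityˡ λ⁻¹))))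
          (solve 3 (λ u t l → t :* u :+ t :* (u :* l) :+ t :* (u :* l) :=
                             t :* (u :+ (u :+ u) :* l)) refl 1# T λ⁻¹))))

  -- Makespans, worst cases and the approximation guarantees

  open Scheduling ℝ
  open Max totalOrder using (_⊔_; x≤x⊔y; x≤y⊔x; ⊔-lub)
  open Computable
  open UncertaintySet

  ≤max : ∀ {k} .{{_ : NonZero k}} (f : Fin k → Carrier) i → f i ≤ max f
  ≤max {suc k} f i = go k f i
    where
    go : ∀ k (f : Fin (suc k) → Carrier) i → f i ≤ Vec.foldr₁ _⊔_ (Vec.tabulate f)
    go zero    f zero    = ≤-refl
    go (suc k) f zero    = x≤x⊔y (f zero) _
    go (suc k) f (suc i) = ≤-trans (go k (f ∘ suc) i) (x≤y⊔x (f zero) _)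

  max≤ : ∀ {k} .{{_ : NonZero k}} (f : Fin k → Carrier) {b} → (∀ i → f i ≤ b) → max f ≤ b
  max≤ {suc k} f f≤b = go k f f≤b
    where
    go : ∀ k (f : Fin (suc k) → Carrier) {b} → (∀ i → f i ≤ b) → Vec.foldr₁ _⊔_ (Vec.tabulate f) ≤ b
    go zero    f f≤b = f≤b zero
    go (suc k) f f≤b = ⊔-lub (f≤b zero) (go k (f ∘ suc) (f≤b ∘ suc))

  load≡machineLoad : ∀ {m n} (σ : Schedule m n) (p : Scenario n) i →
                     load (part σ i) p ≡ machineLoad σ (Vec.lookup p) i
  load≡machineLoad σ p i = sum-cong-≗ (λ j → cong (if_then Vec.lookup p j else 0#)
    (lookup∘tabulate (λ j → does (σ j ≟ i)) j))

  machineLoad≤Cmax : ∀ {m n} (σ : Schedule (suc m) n) p i → machineLoad σ (Vec.lookup p) i ≤ Cmax σ p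
  machineLoad≤Cmax σ p i = subst (_≤ Cmax σ p) (load≡machineLoad σ p i) (≤max (λ i → load (part σ i) p) i)

  Cmax≤ : ∀ {m n} (σ : Schedule (suc m) n) p {b} → (∀ i → machineLoad σ (Vec.lookup p) i ≤ b) → Cmax σ p ≤ b
  Cmax≤ σ p {b} h = max≤ (λ i → load (part σ i) p) (λ i → subst (_≤ b) (sym (load≡machineLoad σ p i)) (h i))

  module _ {𝒰 : UncertaintyClass} {m n : ℕ} (U : UncertaintySet 𝒰 n) (σ : Schedule (suc m) n) where

    -- Nonemptiness and boundedness make `sup` a genuine supremum: if all sizes are at most `b`,
    -- then `n` copies of `b` bound every makespan.
    worstCase-lub : LeastUpperBound (λ x → ∃ λ p → scenarios U p × x ≡ Cmax σ p) (worstCase σ (scenarios U))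
    worstCase-lub with p , Up ← nonEmpty U | b , p≤b ← bounded U =
      sup-lub _ (Cmax σ p , p , Up , refl) (sum {n} (λ _ → b) , λ { _ (p , Up , refl) → Cmax≤ σ p (λ i →
        sum-mono-≤ {n} (λ j → ≤-trans (if-≤ (does (σ j ≟ i)) (nonNegative U p Up j)) (p≤b p Up j))) })

    Cmax≤worstCase : ∀ p → scenarios U p → Cmax σ p ≤ worstCase σ (scenarios U)
    Cmax≤worstCase p Up = proj₁ worstCase-lub _ (p , Up , refl)

    worstCase≤ : ∀ {b} → (∀ p → scenarios U p → Cmax σ p ≤ b) → worstCase σ (scenarios U) ≤ b
    worstCase≤ h = proj₂ worstCase-lub _ λ { _ (p , Up , refl) → h p Up }

  toList≡tabulate : ∀ {n} (p : Scenario n) → Vec.toList p ≡ List.tabulate (Vec.lookup p)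
  toList≡tabulate []      = refl
  toList≡tabulate (x ∷ p) = cong (x ∷_) (toList≡tabulate p)

  n≤sizes-unary : ∀ n → n ℕ.≤ sizes 𝟙 (unary n)
  n≤sizes-unary zero    = z≤n
  n≤sizes-unary (suc n) = s≤s (ℕ.m≤n⇒m≤1+n (n≤sizes-unary n))


  merge-good : ∀ {𝒰 γ γʳᵒᵇ λ′} → 0# < λ′ → ∀ {m n} (U : UncertaintySet 𝒰 n) (p̂ : Scenario n) → scenarios U p̂ →
    (N R : Schedule (suc m) n) → Cmax N p̂ ≤ γ * OPT (suc m) p̂ →
    worstCase R (scenarios U) ≤ γʳᵒᵇ * OPTʳᵒᵇ (suc m) (scenarios U) →
    let σ = merge m (λ′ ⁻¹) (Vec.lookup p̂) N R in
    Cmax σ p̂ ≤ γ * (1# + 2# * λ′ ⁻¹) * OPT (suc m) p̂ ×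
    worstCase σ (scenarios U) ≤ (2# * λ′ + 4#) * γʳᵒᵇ * OPTʳᵒᵇ (suc m) (scenarios U)
  merge-good {γ = γ} {γʳᵒᵇ} {λ′} 0<λ′ {m} {n} U p̂ Up̂ N R N≤ R≤ =
    -- Consistency concerns `p̂` alone, which therefore also serves as the second scenario.
    ≤-trans (Cmax≤ σ p̂ (merge-consistent 0<λ′ {m} {n} {Vec.lookup p̂} {Vec.lookup p̂}
                          0≤p̂ 0≤p̂ N R (part≤ p̂ Up̂)))
      (≤-trans (*-monoʳ-≤ 0≤α (≤-trans T≤ N≤))
        (≤-reflexive (solve 3 (λ g o a → g :* o :* a := g :* a :* o) refl γ (OPT (suc m) p̂) α))) ,
    worstCase≤ U σ (λ q Uq → ≤-trans
      (Cmax≤ σ q (merge-robust 0<λ′ {m} {n} {Vec.lookup p̂} {Vec.lookup q}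
                      0≤p̂ (nonNegative U q Uq) N R (part≤ q Uq)))
      (≤-trans (*-monoˡ-≤ 0≤β R≤) (≤-reflexive (sym (*-assoc β γʳᵒᵇ _)))))
    where
    σ = merge m (λ′ ⁻¹) (Vec.lookup p̂) N R
    α β : Carrier
    α = 1# + 2# * λ′ ⁻¹
    β = 2# * λ′ + 4#
    0≤2 : 0# ≤ 2#
    0≤2 = +-nonNegative 0≤1 0≤1
    0≤α : 0# ≤ α
    0≤α = +-nonNegative 0≤1 (*-nonNegative 2# (λ′ ⁻¹) 0≤2 (⁻¹-nonNegative 0<λ′))
    0≤β : 0# ≤ β
    0≤β = +-nonNegative (*-nonNegative 2# λ′ 0≤2 (proj₁ 0<λ′)) (+-nonNegative 0≤2 0≤2)
    0≤p̂ : NonNegative p̂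
    0≤p̂ = nonNegative U p̂ Up̂
    part≤ : ∀ q → scenarios U q → ∀ k → machineLoad R (Vec.lookup q) k ≤ worstCase R (scenarios U)
    part≤ q Uq k = ≤-trans (machineLoad≤Cmax R q k) (Cmax≤worstCase U R q Uq)
    T≤ : supremum (suc m) (loadOf n N (Vec.lookup p̂)) ≤ Cmax N p̂
    T≤ = supremum-least (suc m) _
      (≤-trans (machineLoad-nonNegative N {Vec.lookup p̂} 0≤p̂ zero) (machineLoad≤Cmax N p̂ zero))
      (λ i → subst (_≤ Cmax N p̂) (sym (loadOf≡machineLoad n N (Vec.lookup p̂) i)) (machineLoad≤Cmax N p̂ i))

  -- Assembling the programs and their running times

  module _ (𝒰 : UncertaintyClass) {γ γʳᵒᵇ α β : Carrier}
           {algorithm : ∀ z → Val schedulesᵗ z → Val (vec jobs (fin machines)) z}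
           (algorithmᶜ : Computes schedulesᵗ (vec jobs (fin machines)) algorithm) where

    private
      C : Ty
      C = UncertaintyClass.Code 𝒰

      total : Poly
      total = algorithmᶜ .cost

    Good : ∀ {m n} → UncertaintySet 𝒰 n → Scenario n → Schedule (suc m) n → Set
    Good {m} U p̂ σ = Cmax σ p̂ ≤ α * OPT (suc m) p̂ ×
                     worstCase σ (scenarios U) ≤ β * OPTʳᵒᵇ (suc m) (scenarios U)

    combinedProgram : Program (nat ⊗ nat ⊗ list real) (list nat) → Program (nat ⊗ nat ⊗ C) (list nat) →
                      Program (nat ⊗ nat ⊗ C ⊗ list real) (list nat)
    combinedProgram P Q = call (algorithmᶜ .program)
      (pair machineCount (pair jobCount (pair prediction (pair
        (call P (pair machineCount (pair jobCount prediction)))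
        (call Q (pair machineCount (pair jobCount (fst (snd (snd v₀))))))))))
      where
      machineCount jobCount : Term _ nat
      machineCount = fst v₀
      jobCount = fst (snd v₀)
      prediction : Term _ (list real)
      prediction = snd (snd (snd v₀))

    combinedProgram-halts : ∀ P Q {μ ν : ⟦ nat ⟧} {c : ⟦ C ⟧} {ps : List Carrier}
                              {Ns Rs σs : List ⟦ nat ⟧} {t u v} →
      (μ , ν , ps) ∷ [] ⊢ P ⇓ Ns ⟨ t ⟩ → (μ , ν , c) ∷ [] ⊢ Q ⇓ Rs ⟨ u ⟩ →
      (μ , ν , ps , Ns , Rs) ∷ [] ⊢ algorithmᶜ .program ⇓ σs ⟨ v ⟩ →
      (μ , ν , c , ps) ∷ [] ⊢ combinedProgram P Q ⇓ σs ⟨ 38 ℕ.+ t ℕ.+ u ℕ.+ v ⟩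
    combinedProgram-halts P Q {μ} {ν} {c} {ps} {σs = σs} {t} {u} {v} N⇓ R⇓ σ⇓ =
      subst (λ t → (μ , ν , c , ps) ∷ [] ⊢ combinedProgram P Q ⇓ σs ⟨ t ⟩) (time-regroup t u v)
        (call (pair (fst (var _)) (pair (fst (snd (var _))) (pair (snd (snd (snd (var _)))) (pair
          (call (pair (fst (var _)) (pair (fst (snd (var _))) (snd (snd (snd (var _)))))) N⇓)
          (call (pair (fst (var _)) (pair (fst (snd (var _))) (fst (snd (snd (var _)))))) R⇓))))) σ⇓)

    combination : (∀ {m n} (U : UncertaintySet 𝒰 n) p̂ → scenarios U p̂ → (N R : Schedule (suc m) n) →
                     Cmax N p̂ ≤ γ * OPT (suc m) p̂ →
                     worstCase R (scenarios U) ≤ γʳᵒᵇ * OPTʳᵒᵇ (suc m) (scenarios U) →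
                     Good U p̂ (algorithm (m , n) (tt , tt , Vec.lookup p̂ , N , R))) →
                  MakespanApproximation γ → RobustApproximation 𝒰 γʳᵒᵇ → LearningAugmented 𝒰 α β
    combination good (P , a , k , P-spec) (Q , b , l , Q-spec) =
      combinedProgram P Q , 38 ℕ.+ a ℕ.+ b ℕ.+ coefficient total , k ℕ.+ l ℕ.+ degree total ,
      λ { (suc m) n (U , p̂ , Up̂) → spec m n U p̂ Up̂ }
      where
      spec : ∀ m n (U : UncertaintySet 𝒰 n) p̂ → scenarios U p̂ →
             let input = unary (suc m) , unary n , code U , encodeScenario p̂ in
             ∃ λ (σ : Schedule (suc m) n) → ∃ λ t →
             ((input ∷ []) ⊢ combinedProgram P Q ⇓ encodeSchedule σ ⟨ t ⟩) ×
             t ℕ.≤ (38 ℕ.+ a ℕ.+ b ℕ.+ coefficient total) ℕ.+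
                   (38 ℕ.+ a ℕ.+ b ℕ.+ coefficient total) ℕ.*
                   size (nat ⊗ nat ⊗ C ⊗ list real) input ℕ.^ (k ℕ.+ l ℕ.+ degree total) ×
             Good U p̂ σ
      spec m n U p̂ Up̂ =
        let N , t , N⇓ , t≤ , N-good = P-spec (suc m) n (p̂ , nonNegative U p̂ Up̂)
            R , u , R⇓ , u≤ , R-good = Q-spec (suc m) n U
            v , σ⇓ , v≤ = algorithmᶜ .correct (m , n) (tt , tt , Vec.lookup p̂ , N , R)
        in algorithm (m , n) (tt , tt , Vec.lookup p̂ , N , R) , 38 ℕ.+ t ℕ.+ u ℕ.+ v ,
           combinedProgram-halts P Q N⇓ R⇓
             (subst (λ ps → (unary (suc m) , unary n , ps , encodeSchedule N , encodeSchedule R) ∷ []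
                              ⊢ algorithmᶜ .program
                              ⇓ encodeSchedule (algorithm (m , n) (tt , tt , Vec.lookup p̂ , N , R)) ⟨ v ⟩)
               (sym (toList≡tabulate p̂)) σ⇓) ,
           polynomial-sum 38 a k b l (coefficient total) (degree total) (s≤s z≤n)
             (ℕ.≤-trans t≤ (ℕ.+-monoʳ-≤ a (ℕ.*-monoʳ-≤ a (ℕ.^-monoˡ-≤ k P-size))))
             (ℕ.≤-trans u≤ (ℕ.+-monoʳ-≤ b (ℕ.*-monoʳ-≤ b (ℕ.^-monoˡ-≤ l Q-size))))
             (ℕ.≤-trans v≤ (ℕ.≤-trans (eval-bound total (scale (m , n)))
               (ℕ.*-monoʳ-≤ (coefficient total) (ℕ.^-monoˡ-≤ (degree total) scale≤)))) ,
           good U p̂ Up̂ N R N-good R-good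
        where
        S sₘ sₙ : ℕ
        S = size (nat ⊗ nat ⊗ C ⊗ list real) (unary (suc m) , unary n , code U , encodeScenario p̂)
        sₘ = sizes 𝟙 (unary (suc m))
        sₙ = sizes 𝟙 (unary n)
        P-size : suc (sₘ ℕ.+ suc (sₙ ℕ.+ sizes real (encodeScenario p̂))) ℕ.≤ S
        P-size = s≤s (ℕ.+-monoʳ-≤ sₘ (s≤s (ℕ.+-monoʳ-≤ sₙ (ℕ.m≤n⇒m≤1+n (ℕ.m≤n+m _ (size C (code U)))))))
        Q-size : suc (sₘ ℕ.+ suc (sₙ ℕ.+ size C (code U))) ℕ.≤ S
        Q-size = s≤s (ℕ.+-monoʳ-≤ sₘ (s≤s (ℕ.+-monoʳ-≤ sₙ (ℕ.m≤n⇒m≤1+n (ℕ.m≤m+n (size C (code U)) _)))))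
        scale≤ : scale (m , n) ℕ.≤ S
        scale≤ = ℕ.m≤n⇒m≤1+n (ℕ.+-mono-≤ (n≤sizes-unary (suc m))
          (ℕ.m≤n⇒m≤1+n (ℕ.≤-trans (n≤sizes-unary n) (ℕ.m≤m+n sₙ _))))

corollary28 : (ℝ : CompleteOrderedField) →
    let open CompleteOrderedField ℝ
        open Scheduling ℝ
    in (𝒰 : UncertaintyClass) (γ γʳᵒᵇ : Carrier) →
       MakespanApproximation γ →
       RobustApproximation 𝒰 γʳᵒᵇ →
       ∀ λ′ → 0# < λ′ →
       LearningAugmented 𝒰 (γ * (1# + 2# * λ′ ⁻¹)) ((2# * λ′ + 4#) * γʳᵒᵇ)
corollary28 ℝ 𝒰 γ γʳᵒᵇ makespan robust λ′ 0<λ′ =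
  combination 𝒰 (mergeᶜ (λ′ ⁻¹)) (merge-good 0<λ′) makespan robust
  where
  open CompleteOrderedField ℝ
  open Algorithm ℝ
  open Combination ℝ
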